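{- Let $G$ be a graph with $m\ge 1$ edges and minimum degree $\delta$, and let $\alpha>0$ be real. Then $$SDD_\alpha(G)\ge 2\,\delta^{2\alpha}\,m\,\bigl(NK^*(G)\bigr)^{ -\alpha/m},$$ and equality is attained if and only if $G$ is a regular graph.
   Context: Graphs are finite, simple and undirected. For a graph $G$ with vertex set $V(G)$ and edge set $E(G)$, $d_u$ denotes the degree of the vertex $u$, and $uv$ denotes the edge joining $u$ and $v$. For $\alpha\in\mathbb{R}$, the variable symmetric division deg index is $$SDD_\alpha(G)=\sum_{uv\in E(G)}\left(\frac{d_u^\alpha}{d_v^\alpha}+\frac{d_v^\alpha}{d_u^\alpha}\right).$$ The modified Narumi-Katayama index is $$NK^*(G)=\prod_{u\in V(G)}d_u^{d_u}=\prod_{uv\in E(G)}d_ud_v$$ (with $0^0=1$). A graph is regular if all its vertices have the same degree. -}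

module Defs where

open import Data.Empty using (⊥-elim)
open import Data.Fin as Fin using (Fin)
import Data.Fin.Properties as Fin
open import Data.Integer as ℤ using (ℤ; +_; -[1+_])
import Data.Integer.Properties as ℤ
import Data.Integer.Solver
open import Data.List using (List; allFin; cartesianProduct; filter; foldr; length; map)
open import Data.List.Membership.Propositional.Properties using (∈-allFin; ∈-filter⁺; ∈-length)
open import Data.List.Relation.Unary.All using (reduce)
open import Data.List.Relation.Unary.All.Properties using (all-filter)
open import Data.Nat as ℕ using (ℕ; zero; suc; z≤n; s≤s)
open import Data.Nat.ListAction using (product)
import Data.Nat.Properties as ℕ
import Data.Nat.Solver
open import Data.Product using (∃; _×_; _,_)
open import Data.Rational as ℚ using (ℚ; mkℚ; ↥_; ↧ₙ_; 0ℚ; 1ℚ; ½; ∣_∣)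
import Data.Rational.Properties as ℚ
import Data.Rational.Solver
open import Data.Rational.Unnormalised as ℚᵘ using (mkℚᵘ)
import Data.Rational.Unnormalised.Properties as ℚᵘ
open import Data.Sum using (inj₁; inj₂)
open import Level using (0ℓ)
open import Relation.Binary using (Rel; Irreflexive; Symmetric)
import Relation.Binary as B
open import Relation.Binary.PropositionalEquality
  using (_≡_; refl; sym; trans; cong; cong₂; subst; subst₂)
open import Relation.Nullary using (yes; no)
open import Relation.Nullary.Decidable using (_×-dec_)
open import Relation.Unary using (Decidable)

module ℕ-Solver = Data.Nat.Solver.+-*-Solver
module ℤ-Solver = Data.Integer.Solver.+-*-Solver
module ℚ-Solver = Data.Rational.Solver.+-*-Solver

module Roots where
  open import Data.Nat
  open import Data.Nat.Properties
  open ℕ-Solver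

  greatest : {P : ℕ → Set} → Decidable P → ℕ → ℕ
  greatest P? zero    = zero
  greatest P? (suc b) with P? (suc b)
  ... | yes _ = suc b
  ... | no  _ = greatest P? b

  greatest-sound : {P : ℕ → Set} (P? : Decidable P) → P 0 → ∀ b → P (greatest P? b)
  greatest-sound P? p₀ zero = p₀
  greatest-sound P? p₀ (suc b) with P? (suc b)
  ... | yes p = p
  ... | no  _ = greatest-sound P? p₀ b

  greatest-max : {P : ℕ → Set} (P? : Decidable P) → ∀ b {t} → t ≤ b → P t → t ≤ greatest P? b
  greatest-max P? zero t≤b _ = t≤b
  greatest-max P? (suc b) t≤b p with P? (suc b)
  ... | yes _ = t≤b
  ... | no ¬p = greatest-max P? b (s≤s⁻¹ (≤∧≢⇒< t≤b λ { refl → ¬p p })) p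

  infix 9 _⁺ _⁻
  _⁺ _⁻ : ℤ → ℕ
  (+ n)    ⁺ = n
  -[1+ n ] ⁺ = 0
  (+ n)    ⁻ = 0
  -[1+ n ] ⁻ = suc n

  -- t / N ≤ n ^ r, cleared of roots, negative exponents and denominators.
  AtMostPow : ℕ → ℚ → ℕ → ℕ → Set
  AtMostPow n r N t = t ^ ↧ₙ r * n ^ (↥ r) ⁻ ≤ n ^ (↥ r) ⁺ * N ^ ↧ₙ r

  -- For n ≥ 1: the integer part of N * n ^ r.
  root : ℕ → ℚ → ℕ → ℕ
  root n r N = greatest {AtMostPow n r N} (λ t → _ ≤? _) (n ^ (↥ r) ⁺ * N)

  root-sound : ∀ n r N → AtMostPow n r N (root n r N)
  root-sound n r@record{} N = greatest-sound {AtMostPow n r N} (λ t → _ ≤? _) z≤n (n ^ (↥ r) ⁺ * N)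

  ^-*-distrib : ∀ a b k → (a * b) ^ k ≡ a ^ k * b ^ k
  ^-*-distrib a b zero    = refl
  ^-*-distrib a b (suc k) = trans (cong (a * b *_) (^-*-distrib a b k))
    (solve 4 (λ a b x y → a :* b :* (x :* y) := a :* x :* (b :* y)) refl a b (a ^ k) (b ^ k))

  ^-cancelʳ-≤ : ∀ k .{{_ : NonZero k}} {a b} → a ^ k ≤ b ^ k → a ≤ b
  ^-cancelʳ-≤ k le = ≮⇒≥ λ b<a → <⇒≱ (^-monoˡ-< k b<a) le

  root-maximal : ∀ n .{{_ : NonZero n}} r N →
    n ^ (↥ r) ⁺ * N ^ ↧ₙ r ≤ suc (root n r N) ^ ↧ₙ r * n ^ (↥ r) ⁻
  root-maximal n r@record{} N with suc (root n r N) ≤? n ^ (↥ r) ⁺ * N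
  ... | yes t≤b = <⇒≤ (≰⇒> λ p → 1+n≰n (greatest-max {AtMostPow n r N} (λ t → _ ≤? _) _ t≤b p))
  ... | no  t≰b = begin
    A * N ^ k                 ≤⟨ *-monoˡ-≤ (N ^ k) (m≤m^k) ⟩
    A ^ k * N ^ k             ≡⟨ ^-*-distrib A N k ⟨
    (A * N) ^ k               ≤⟨ ^-monoˡ-≤ k (<⇒≤ (≰⇒> t≰b)) ⟩
    T ^ k                     ≤⟨ m≤m*n (T ^ k) (n ^ (↥ r) ⁻) {{m^n≢0 n ((↥ r) ⁻)}} ⟩
    T ^ k * n ^ (↥ r) ⁻       ∎
    where
    open ≤-Reasoning
    k = ↧ₙ r
    A = n ^ (↥ r) ⁺
    T = suc (root n r N)
    m≤m^k : A ≤ A ^ k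
    m≤m^k = subst (_≤ A ^ k) (^-identityʳ A) (^-monoʳ-≤ A {{m^n≢0 n ((↥ r) ⁺)}} (s≤s (z≤n {ℚ.ℚ.denominator-1 r})))

  bernoulli : ∀ K n j → K ^ j * (K + j * n) ≤ (K + n) ^ j * K
  bernoulli K n zero    = ≤-reflexive (cong (λ x → x + 0) (+-identityʳ K))
  bernoulli K n (suc j) = begin
    K * K ^ j * (K + suc j * n)                        ≤⟨ m≤m+n _ _ ⟩
    K * K ^ j * (K + suc j * n) + K ^ j * (j * n * n)  ≡⟨ solve 4 (λ K n j x →
        K :* x :* (K :+ (con 1 :+ j) :* n) :+ x :* (j :* n :* n) := (K :+ n) :* (x :* (K :+ j :* n)))
        refl K n j (K ^ j) ⟩
    (K + n) * (K ^ j * (K + j * n))                    ≤⟨ *-monoʳ-≤ (K + n) (bernoulli K n j) ⟩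
    (K + n) * ((K + n) ^ j * K)                        ≡⟨ *-assoc (K + n) _ K ⟨
    (K + n) ^ suc j * K                                ∎
    where open ≤-Reasoning

  n*K^K≤[K+n]^K : ∀ n K .{{_ : NonZero K}} → n * K ^ K ≤ (K + n) ^ K
  n*K^K≤[K+n]^K n K = *-cancelʳ-≤ _ _ K (begin
    n * K ^ K * K            ≡⟨ solve 3 (λ n K x → n :* x :* K := x :* (K :* n)) refl n K (K ^ K) ⟩
    K ^ K * (K * n)          ≤⟨ *-monoʳ-≤ (K ^ K) (m≤n+m (K * n) K) ⟩
    K ^ K * (K + K * n)      ≤⟨ bernoulli K n K ⟩
    (K + n) ^ K * K          ∎)
    where open ≤-Reasoning

  private
    raise : ∀ {a b c d} e → a * b ≤ c * d → a ^ e * b ^ e ≤ c ^ e * d ^ e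
    raise {a} {b} {c} {d} e le =
      subst₂ _≤_ (^-*-distrib a b e) (^-*-distrib c d e) (^-monoˡ-≤ e le)

  modulus : ∀ n .{{_ : NonZero n}} k l K .{{_ : NonZero k}} .{{_ : NonZero l}} .{{_ : NonZero K}}
    {p⁺ p⁻ q⁺ q⁻ N M s t} →
    n ^ p⁺ * N ^ k ≤ s ^ k * n ^ p⁻ →
    t ^ l * n ^ q⁻ ≤ n ^ q⁺ * M ^ l →
    q⁺ * (k * K) + p⁻ * (l * K) ≤ p⁺ * (l * K) + q⁻ * (k * K) + l * k →
    t * (N * K) ≤ M * (s * (K + n))
  modulus n k l K {p⁺} {p⁻} {q⁺} {q⁻} {N} {M} {s} {t} hs ht he =
    ^-cancelʳ-≤ e {{m*n≢0 (l * k) K {{m*n≢0 l k}}}} (*-cancelʳ-≤ _ _ (n ^ X) {{m^n≢0 n X}} (begin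
      (t * (N * K)) ^ e * n ^ X
        ≤⟨ *-monoʳ-≤ ((t * (N * K)) ^ e) (^-monoʳ-≤ n he) ⟩
      (t * (N * K)) ^ e * n ^ (p⁺ * (l * K) + q⁻ * (k * K) + l * k)
        ≡⟨ cong₂ _*_ (trans (^-*-distrib t (N * K) e) (cong (t ^ e *_) (^-*-distrib N K e)))
                     (trans (^-distribˡ-+-* n (p⁺ * (l * K) + q⁻ * (k * K)) (l * k))
                            (cong (_* n ^ (l * k)) (^-distribˡ-+-* n (p⁺ * (l * K)) (q⁻ * (k * K))))) ⟩
      t ^ e * (N ^ e * K ^ e) * (n ^ (p⁺ * (l * K)) * n ^ (q⁻ * (k * K)) * n ^ (l * k))
        ≡⟨ solve 6 (λ a b c x y z → a :* (b :* c) :* (x :* y :* z) := (a :* y) :* (x :* b) :* (z :* c))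
             refl (t ^ e) (N ^ e) (K ^ e) (n ^ (p⁺ * (l * K))) (n ^ (q⁻ * (k * K))) (n ^ (l * k)) ⟩
      (t ^ e * n ^ (q⁻ * (k * K))) * (n ^ (p⁺ * (l * K)) * N ^ e) * (n ^ (l * k) * K ^ e)
        ≤⟨ *-mono-≤ (*-mono-≤ ht′ hs′) hK ⟩
      (n ^ (q⁺ * (k * K)) * M ^ e) * (s ^ e * n ^ (p⁻ * (l * K))) * (K + n) ^ e
        ≡⟨ solve 5 (λ a b c d f → (a :* b) :* (c :* d) :* f := b :* (c :* f) :* (a :* d))
             refl (n ^ (q⁺ * (k * K))) (M ^ e) (s ^ e) (n ^ (p⁻ * (l * K))) ((K + n) ^ e) ⟩
      M ^ e * (s ^ e * (K + n) ^ e) * (n ^ (q⁺ * (k * K)) * n ^ (p⁻ * (l * K)))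
        ≡⟨ cong₂ _*_ (trans (^-*-distrib M (s * (K + n)) e) (cong (M ^ e *_) (^-*-distrib s (K + n) e)))
                     (^-distribˡ-+-* n (q⁺ * (k * K)) (p⁻ * (l * K))) ⟨
      (M * (s * (K + n))) ^ e * n ^ X ∎))
    where
    open ≤-Reasoning
    e = l * k * K
    X = q⁺ * (k * K) + p⁻ * (l * K)
    pw : ∀ a x y {z} → x * y ≡ z → (a ^ x) ^ y ≡ a ^ z
    pw a x y eq = trans (^-*-assoc a x y) (cong (a ^_) eq)
    ek : k * (l * K) ≡ e
    ek = solve 3 (λ k l K → k :* (l :* K) := l :* k :* K) refl k l K
    ht′ : t ^ e * n ^ (q⁻ * (k * K)) ≤ n ^ (q⁺ * (k * K)) * M ^ e
    ht′ = subst₂ _≤_ (cong₂ _*_ (pw t l (k * K) (sym (*-assoc l k K))) (pw n q⁻ (k * K) refl))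
                     (cong₂ _*_ (pw n q⁺ (k * K) refl) (pw M l (k * K) (sym (*-assoc l k K))))
                     (raise (k * K) ht)
    hs′ : n ^ (p⁺ * (l * K)) * N ^ e ≤ s ^ e * n ^ (p⁻ * (l * K))
    hs′ = subst₂ _≤_ (cong₂ _*_ (pw n p⁺ (l * K) refl) (pw N k (l * K) ek))
                     (cong₂ _*_ (pw s k (l * K) ek) (pw n p⁻ (l * K) refl))
                     (raise (l * K) hs)
    hK : n ^ (l * k) * K ^ e ≤ (K + n) ^ e
    hK = subst₂ _≤_ (trans (^-*-distrib n (K ^ K) (l * k)) (cong (n ^ (l * k) *_) (pw K K (l * k) (*-comm K (l * k)))))
                    (pw (K + n) K (l * k) (*-comm K (l * k)))
                    (^-monoˡ-≤ (l * k) (n*K^K≤[K+n]^K n K))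

  pow-upper : ∀ n .{{_ : NonZero n}} k .{{_ : NonZero k}} {p⁺ p⁻ N t B} →
    t ^ k * n ^ p⁻ ≤ n ^ p⁺ * N ^ k → p⁺ ≤ B * k → t ≤ n ^ B * N
  pow-upper n k {p⁺} {p⁻} {N} {t} {B} ht p≤ = ^-cancelʳ-≤ k (begin
    t ^ k             ≤⟨ m≤m*n (t ^ k) (n ^ p⁻) {{m^n≢0 n p⁻}} ⟩
    t ^ k * n ^ p⁻    ≤⟨ ht ⟩
    n ^ p⁺ * N ^ k    ≤⟨ *-monoˡ-≤ (N ^ k) (^-monoʳ-≤ n p≤) ⟩
    n ^ (B * k) * N ^ k ≡⟨ cong (_* N ^ k) (^-*-assoc n B k) ⟨
    (n ^ B) ^ k * N ^ k ≡⟨ ^-*-distrib (n ^ B) N k ⟨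
    (n ^ B * N) ^ k   ∎)
    where open ≤-Reasoning

  pow-lower : ∀ n .{{_ : NonZero n}} k .{{_ : NonZero k}} {p⁺ p⁻ N s B} →
    n ^ p⁺ * N ^ k ≤ s ^ k * n ^ p⁻ → p⁻ ≤ B * k → N ≤ s * n ^ B
  pow-lower n k {p⁺} {p⁻} {N} {s} {B} hs p≤ = ^-cancelʳ-≤ k (begin
    N ^ k             ≤⟨ m≤n*m (N ^ k) (n ^ p⁺) {{m^n≢0 n p⁺}} ⟩
    n ^ p⁺ * N ^ k    ≤⟨ hs ⟩
    s ^ k * n ^ p⁻    ≤⟨ *-monoʳ-≤ (s ^ k) (^-monoʳ-≤ n p≤) ⟩
    s ^ k * n ^ (B * k) ≡⟨ cong (s ^ k *_) (^-*-assoc n B k) ⟨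
    s ^ k * (n ^ B) ^ k ≡⟨ ^-*-distrib s (n ^ B) k ⟨
    (s * n ^ B) ^ k   ∎)
    where open ≤-Reasoning

open Roots public

module Rationals where
  open ℚ-Solver

  abs-≤ : ∀ {p q} → p ℚ.≤ q → ℚ.- p ℚ.≤ q → ∣ p ∣ ℚ.≤ q
  abs-≤ {p} {q} p≤q -p≤q with ℚ.∣p∣≡p∨∣p∣≡-p p
  ... | inj₁ eq = subst (ℚ._≤ q) (sym eq) p≤q
  ... | inj₂ eq = subst (ℚ._≤ q) (sym eq) -p≤q

  p≤∣p∣ : ∀ p → p ℚ.≤ ∣ p ∣
  p≤∣p∣ p with ℚ.≤-total 0ℚ p
  ... | inj₁ 0≤p = ℚ.≤-reflexive (sym (ℚ.0≤p⇒∣p∣≡p 0≤p))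
  ... | inj₂ p≤0 = ℚ.≤-trans p≤0 (ℚ.0≤∣p∣ p)

  ∣p-q∣≡∣q-p∣ : ∀ p q → ∣ p ℚ.- q ∣ ≡ ∣ q ℚ.- p ∣
  ∣p-q∣≡∣q-p∣ p q = trans (sym (ℚ.∣-p∣≡∣p∣ (p ℚ.- q)))
    (cong ∣_∣ (solve 2 (λ p q → :- (p :- q) := q :- p) refl p q))

  *-pos : ∀ {p q} → 0ℚ ℚ.< p → 0ℚ ℚ.< q → 0ℚ ℚ.< p ℚ.* q
  *-pos {p} {q} p>0 q>0 =
    ℚ.positive⁻¹ (p ℚ.* q) {{ℚ.pos*pos⇒pos p {{ℚ.positive p>0}} q {{ℚ.positive q>0}}}}

  *-mono : ∀ {p q r s} → 0ℚ ℚ.≤ p → 0ℚ ℚ.≤ s → p ℚ.≤ q → r ℚ.≤ s → p ℚ.* r ℚ.≤ q ℚ.* s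
  *-mono {p} {q} {r} {s} 0≤p 0≤s p≤q r≤s = ℚ.≤-trans
    (ℚ.*-monoˡ-≤-nonNeg p {{ℚ.nonNegative 0≤p}} r≤s)
    (ℚ.*-monoʳ-≤-nonNeg s {{ℚ.nonNegative 0≤s}} p≤q)

  ½+½ : ∀ ε → ½ ℚ.* ε ℚ.+ ½ ℚ.* ε ≡ ε
  ½+½ ε = trans (sym (ℚ.*-distribʳ-+ ε ½ ½)) (ℚ.*-identityˡ ε)

  ½-pos : ∀ {ε} → 0ℚ ℚ.< ε → 0ℚ ℚ.< ½ ℚ.* ε
  ½-pos = *-pos {½} (ℚ.positive⁻¹ ½)

  -- Total on ℚ, with inv 0 = 0.
  inv : ℚ → ℚ
  inv q with q ℚ.≟ 0ℚ
  ... | yes _  = 0ℚ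
  ... | no q≢0 = ℚ.1/_ q {{ℚ.≢-nonZero q≢0}}

  inv-inverse : ∀ {q} → 0ℚ ℚ.< q → q ℚ.* inv q ≡ 1ℚ
  inv-inverse {q} q>0 with q ℚ.≟ 0ℚ
  ... | yes refl = ⊥-elim (ℚ.<-irrefl refl q>0)
  ... | no q≢0   = ℚ.*-inverseʳ q {{ℚ.≢-nonZero q≢0}}

  inv-pos : ∀ {q} → 0ℚ ℚ.< q → 0ℚ ℚ.< inv q
  inv-pos {q} q>0 with q ℚ.≟ 0ℚ
  ... | yes refl = ⊥-elim (ℚ.<-irrefl refl q>0)
  ... | no q≢0   = ℚ.positive⁻¹ _ {{ℚ.1/pos⇒pos q {{ℚ.positive q>0}}}}

  inv-anti : ∀ {p q} → 0ℚ ℚ.< p → p ℚ.≤ q → inv q ℚ.≤ inv p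
  inv-anti {p} {q} p>0 p≤q = subst₂ ℚ._≤_
    (trans (solve 3 (λ p a b → p :* (a :* b) := p :* a :* b) refl p (inv p) (inv q))
           (trans (cong (ℚ._* inv q) (inv-inverse p>0)) (ℚ.*-identityˡ (inv q))))
    (trans (solve 3 (λ q a b → q :* (a :* b) := q :* b :* a) refl q (inv p) (inv q))
           (trans (cong (ℚ._* inv p) (inv-inverse q>0)) (ℚ.*-identityˡ (inv p))))
    (ℚ.*-monoʳ-≤-nonNeg (inv p ℚ.* inv q) {{ℚ.nonNegative (ℚ.<⇒≤ (*-pos (inv-pos p>0) (inv-pos q>0)))}} p≤q)
    where
    q>0 : 0ℚ ℚ.< q
    q>0 = ℚ.<-≤-trans p>0 p≤q

  p-q≤ε⇒p≤q+ε : ∀ {p q ε} → p ℚ.- q ℚ.≤ ε → p ℚ.≤ q ℚ.+ ε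
  p-q≤ε⇒p≤q+ε {p} {q} {ε} le = subst (ℚ._≤ q ℚ.+ ε)
    (solve 2 (λ p q → q :+ (p :- q) := p) refl p q) (ℚ.+-monoʳ-≤ q le)

  p≤q+ε⇒p-q≤ε : ∀ {p q ε} → p ℚ.≤ q ℚ.+ ε → p ℚ.- q ℚ.≤ ε
  p≤q+ε⇒p-q≤ε {p} {q} {ε} le = subst (p ℚ.- q ℚ.≤_)
    (solve 2 (λ q ε → (q :+ ε) :- q := ε) refl q ε) (ℚ.+-monoˡ-≤ (ℚ.- q) le)

open Rationals public

record ℝ : Set where
  constructor mkℝ
  field
    seq    : ℕ → ℚ
    cauchy : ∀ ε → 0ℚ ℚ.< ε → ∃ λ N → ∀ i j → N ℕ.≤ i → N ℕ.≤ j → ∣ seq i ℚ.- seq j ∣ ℚ.≤ ε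
open ℝ public

infix 4 _≃ᵣ_ _≤ᵣ_ _≥ᵣ_ _<ᵣ_
record _≃ᵣ_ (x y : ℝ) : Set where
  constructor *≃*
  field ≃-within : ∀ ε → 0ℚ ℚ.< ε → ∃ λ N → ∀ i → N ℕ.≤ i → ∣ seq x i ℚ.- seq y i ∣ ℚ.≤ ε

record _≤ᵣ_ (x y : ℝ) : Set where
  constructor *≤*
  field ≤-within : ∀ ε → 0ℚ ℚ.< ε → ∃ λ N → ∀ i → N ℕ.≤ i → seq x i ℚ.≤ seq y i ℚ.+ ε

record _<ᵣ_ (x y : ℝ) : Set where
  constructor *<*
  field <-apart : ∃ λ ε → 0ℚ ℚ.< ε × ∃ λ N → ∀ i → N ℕ.≤ i → seq x i ℚ.+ ε ℚ.≤ seq y i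

_≥ᵣ_ : ℝ → ℝ → Set
x ≥ᵣ y = y ≤ᵣ x

fromℚ : ℚ → ℝ
fromℚ q = mkℝ (λ _ → q) λ ε ε>0 →
  0 , λ _ _ _ _ → ℚ.≤-trans (ℚ.≤-reflexive (cong ∣_∣ (ℚ.+-inverseʳ q))) (ℚ.<⇒≤ ε>0)

fromℕ : ℕ → ℝ
fromℕ n = fromℚ (+ n ℚ./ 1)

0ᵣ : ℝ
0ᵣ = fromℚ 0ℚ

module Arithmetic where
  open ℚ-Solver

  infixl 6 _+ᵣ_
  infixl 7 _*ᵣ_
  infix 8 -ᵣ_

  -ᵣ_ : ℝ → ℝ
  -ᵣ x = mkℝ (λ i → ℚ.- seq x i) λ ε ε>0 → let N , h = cauchy x ε ε>0 in
    N , λ i j N≤i N≤j → subst (ℚ._≤ ε)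
      (trans (∣p-q∣≡∣q-p∣ (seq x i) (seq x j)) (cong ∣_∣ (solve 2 (λ a b → b :- a := (:- a) :- (:- b)) refl (seq x i) (seq x j))))
      (h i j N≤i N≤j)

  _+ᵣ_ : ℝ → ℝ → ℝ
  x +ᵣ y = mkℝ (λ i → seq x i ℚ.+ seq y i) λ ε ε>0 →
    let N , hx = cauchy x (½ ℚ.* ε) (½-pos ε>0)
        M , hy = cauchy y (½ ℚ.* ε) (½-pos ε>0)
    in N ℕ.⊔ M , λ i j ≤i ≤j → begin
      ∣ (seq x i ℚ.+ seq y i) ℚ.- (seq x j ℚ.+ seq y j) ∣
        ≡⟨ cong ∣_∣ (solve 4 (λ a b c d → (a :+ b) :- (c :+ d) := (a :- c) :+ (b :- d)) refl
             (seq x i) (seq y i) (seq x j) (seq y j)) ⟩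
      ∣ (seq x i ℚ.- seq x j) ℚ.+ (seq y i ℚ.- seq y j) ∣
        ≤⟨ ℚ.∣p+q∣≤∣p∣+∣q∣ (seq x i ℚ.- seq x j) (seq y i ℚ.- seq y j) ⟩
      ∣ seq x i ℚ.- seq x j ∣ ℚ.+ ∣ seq y i ℚ.- seq y j ∣
        ≤⟨ ℚ.+-mono-≤ (hx i j (ℕ.≤-trans (ℕ.m≤m⊔n N M) ≤i) (ℕ.≤-trans (ℕ.m≤m⊔n N M) ≤j))
                      (hy i j (ℕ.≤-trans (ℕ.m≤n⊔m N M) ≤i) (ℕ.≤-trans (ℕ.m≤n⊔m N M) ≤j)) ⟩
      ½ ℚ.* ε ℚ.+ ½ ℚ.* ε
        ≡⟨ ½+½ ε ⟩
      ε ∎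
    where open ℚ.≤-Reasoning

  bounded : ∀ x → ∃ λ B → 0ℚ ℚ.< B × ∃ λ N → ∀ i → N ℕ.≤ i → ∣ seq x i ∣ ℚ.≤ B
  bounded x = let N , h = cauchy x 1ℚ (ℚ.positive⁻¹ 1ℚ) in
    1ℚ ℚ.+ ∣ seq x N ∣ ,
    ℚ.+-mono-<-≤ (ℚ.positive⁻¹ 1ℚ) (ℚ.0≤∣p∣ (seq x N)) ,
    N , λ i N≤i → begin
      ∣ seq x i ∣
        ≡⟨ cong ∣_∣ (solve 2 (λ a b → a := (a :- b) :+ b) refl (seq x i) (seq x N)) ⟩
      ∣ (seq x i ℚ.- seq x N) ℚ.+ seq x N ∣
        ≤⟨ ℚ.∣p+q∣≤∣p∣+∣q∣ (seq x i ℚ.- seq x N) (seq x N) ⟩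
      ∣ seq x i ℚ.- seq x N ∣ ℚ.+ ∣ seq x N ∣
        ≤⟨ ℚ.+-monoˡ-≤ ∣ seq x N ∣ (h i N N≤i ℕ.≤-refl) ⟩
      1ℚ ℚ.+ ∣ seq x N ∣ ∎
    where open ℚ.≤-Reasoning

  _*ᵣ_ : ℝ → ℝ → ℝ
  x *ᵣ y = mkℝ (λ i → seq x i ℚ.* seq y i) λ ε ε>0 →
    let B , B>0 , N₁ , hB = bounded x
        C , C>0 , N₂ , hC = bounded y
        B+C>0 = ℚ.+-mono-< B>0 C>0
        δ   = ε ℚ.* inv (B ℚ.+ C)
        δ>0 = *-pos ε>0 (inv-pos B+C>0)
        N₃ , hx = cauchy x δ δ>0
        N₄ , hy = cauchy y δ δ>0
        N = (N₁ ℕ.⊔ N₂) ℕ.⊔ (N₃ ℕ.⊔ N₄)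
        N₁≤N = ℕ.≤-trans (ℕ.m≤m⊔n N₁ N₂) (ℕ.m≤m⊔n (N₁ ℕ.⊔ N₂) (N₃ ℕ.⊔ N₄))
        N₂≤N = ℕ.≤-trans (ℕ.m≤n⊔m N₁ N₂) (ℕ.m≤m⊔n (N₁ ℕ.⊔ N₂) (N₃ ℕ.⊔ N₄))
        N₃≤N = ℕ.≤-trans (ℕ.m≤m⊔n N₃ N₄) (ℕ.m≤n⊔m (N₁ ℕ.⊔ N₂) (N₃ ℕ.⊔ N₄))
        N₄≤N = ℕ.≤-trans (ℕ.m≤n⊔m N₃ N₄) (ℕ.m≤n⊔m (N₁ ℕ.⊔ N₂) (N₃ ℕ.⊔ N₄))
    in N , λ i j N≤i N≤j → begin
      ∣ seq x i ℚ.* seq y i ℚ.- seq x j ℚ.* seq y j ∣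
        ≡⟨ cong ∣_∣ (solve 4 (λ a b c d → a :* b :- c :* d := a :* (b :- d) :+ (a :- c) :* d) refl
             (seq x i) (seq y i) (seq x j) (seq y j)) ⟩
      ∣ seq x i ℚ.* (seq y i ℚ.- seq y j) ℚ.+ (seq x i ℚ.- seq x j) ℚ.* seq y j ∣
        ≤⟨ ℚ.∣p+q∣≤∣p∣+∣q∣ (seq x i ℚ.* (seq y i ℚ.- seq y j)) ((seq x i ℚ.- seq x j) ℚ.* seq y j) ⟩
      ∣ seq x i ℚ.* (seq y i ℚ.- seq y j) ∣ ℚ.+ ∣ (seq x i ℚ.- seq x j) ℚ.* seq y j ∣
        ≡⟨ cong₂ ℚ._+_ (ℚ.∣p*q∣≡∣p∣*∣q∣ (seq x i) (seq y i ℚ.- seq y j))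
                       (ℚ.∣p*q∣≡∣p∣*∣q∣ (seq x i ℚ.- seq x j) (seq y j)) ⟩
      ∣ seq x i ∣ ℚ.* ∣ seq y i ℚ.- seq y j ∣ ℚ.+ ∣ seq x i ℚ.- seq x j ∣ ℚ.* ∣ seq y j ∣
        ≤⟨ ℚ.+-mono-≤
             (*-mono (ℚ.0≤∣p∣ (seq x i)) (ℚ.<⇒≤ δ>0) (hB i (ℕ.≤-trans N₁≤N N≤i))
                (hy i j (ℕ.≤-trans N₄≤N N≤i) (ℕ.≤-trans N₄≤N N≤j)))
             (*-mono (ℚ.0≤∣p∣ (seq x i ℚ.- seq x j)) (ℚ.<⇒≤ C>0)
                (hx i j (ℕ.≤-trans N₃≤N N≤i) (ℕ.≤-trans N₃≤N N≤j)) (hC j (ℕ.≤-trans N₂≤N N≤j))) ⟩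
      B ℚ.* δ ℚ.+ δ ℚ.* C
        ≡⟨ solve 4 (λ B C e i → B :* (e :* i) :+ (e :* i) :* C := e :* ((B :+ C) :* i)) refl
             B C ε (inv (B ℚ.+ C)) ⟩
      ε ℚ.* ((B ℚ.+ C) ℚ.* inv (B ℚ.+ C))
        ≡⟨ cong (ε ℚ.*_) (inv-inverse B+C>0) ⟩
      ε ℚ.* 1ℚ
        ≡⟨ ℚ.*-identityʳ ε ⟩
      ε ∎
    where open ℚ.≤-Reasoning

  infixl 7 _/ᵣ_[_]

  recip : (y : ℝ) → 0ᵣ <ᵣ y → ℝ
  recip y (*<* (η , η>0 , M , hη)) = mkℝ (λ i → inv (seq y i)) λ ε ε>0 →
    let δ   = ε ℚ.* (η ℚ.* η)
        δ>0 = *-pos ε>0 (*-pos η>0 η>0)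
        N , hy = cauchy y δ δ>0
    in M ℕ.⊔ N , λ i j ≤i ≤j →
    let a = seq y i
        b = seq y j
        η≤a = subst (ℚ._≤ a) (ℚ.+-identityˡ η) (hη i (ℕ.≤-trans (ℕ.m≤m⊔n M N) ≤i))
        η≤b = subst (ℚ._≤ b) (ℚ.+-identityˡ η) (hη j (ℕ.≤-trans (ℕ.m≤m⊔n M N) ≤j))
        a>0 = ℚ.<-≤-trans η>0 η≤a
        b>0 = ℚ.<-≤-trans η>0 η≤b
        0≤a⁻¹b⁻¹ = ℚ.<⇒≤ (*-pos (inv-pos a>0) (inv-pos b>0))
    in begin
      ∣ inv a ℚ.- inv b ∣
        ≡⟨ cong ∣_∣ (cong₂ ℚ._-_
             (trans (sym (ℚ.*-identityʳ (inv a))) (cong (inv a ℚ.*_) (sym (inv-inverse b>0))))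
             (trans (sym (ℚ.*-identityˡ (inv b))) (cong (ℚ._* inv b) (sym (inv-inverse a>0))))) ⟩
      ∣ inv a ℚ.* (b ℚ.* inv b) ℚ.- a ℚ.* inv a ℚ.* inv b ∣
        ≡⟨ cong ∣_∣ (solve 4 (λ a b u v → u :* (b :* v) :- a :* u :* v := (b :- a) :* (u :* v)) refl
             a b (inv a) (inv b)) ⟩
      ∣ (b ℚ.- a) ℚ.* (inv a ℚ.* inv b) ∣
        ≡⟨ ℚ.∣p*q∣≡∣p∣*∣q∣ (b ℚ.- a) (inv a ℚ.* inv b) ⟩
      ∣ b ℚ.- a ∣ ℚ.* ∣ inv a ℚ.* inv b ∣
        ≡⟨ cong (∣ b ℚ.- a ∣ ℚ.*_) (ℚ.0≤p⇒∣p∣≡p 0≤a⁻¹b⁻¹) ⟩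
      ∣ b ℚ.- a ∣ ℚ.* (inv a ℚ.* inv b)
        ≤⟨ *-mono (ℚ.0≤∣p∣ (b ℚ.- a)) (ℚ.<⇒≤ (*-pos (inv-pos η>0) (inv-pos η>0)))
             (hy j i (ℕ.≤-trans (ℕ.m≤n⊔m M N) ≤j) (ℕ.≤-trans (ℕ.m≤n⊔m M N) ≤i))
             (*-mono (ℚ.<⇒≤ (inv-pos a>0)) (ℚ.<⇒≤ (inv-pos η>0)) (inv-anti η>0 η≤a) (inv-anti η>0 η≤b)) ⟩
      δ ℚ.* (inv η ℚ.* inv η)
        ≡⟨ solve 3 (λ e a b → e :* (a :* a) :* (b :* b) := e :* (a :* b) :* (a :* b)) refl ε η (inv η) ⟩
      ε ℚ.* (η ℚ.* inv η) ℚ.* (η ℚ.* inv η)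
        ≡⟨ cong (λ z → ε ℚ.* z ℚ.* z) (inv-inverse η>0) ⟩
      ε ℚ.* 1ℚ ℚ.* 1ℚ
        ≡⟨ trans (ℚ.*-identityʳ (ε ℚ.* 1ℚ)) (ℚ.*-identityʳ ε) ⟩
      ε ∎
    where open ℚ.≤-Reasoning

  _/ᵣ_[_] : (x y : ℝ) → 0ᵣ <ᵣ y → ℝ
  x /ᵣ y [ 0<y ] = x *ᵣ recip y 0<y

open Arithmetic public

⁺-⁻ : ∀ z → z ≡ + (z ⁺) ℤ.- + (z ⁻)
⁺-⁻ (+ n)    = sym (ℤ.+-identityʳ (+ n))
⁺-⁻ -[1+ n ] = refl

fraction-≤ : ∀ {t t′} n m e → let N = suc n ; M = suc m ; E = suc e in
  t′ ℕ.* (N ℕ.* E) ℕ.≤ (t ℕ.* E ℕ.+ N) ℕ.* M →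
  + t′ ℚ./ M ℚ.≤ + t ℚ./ N ℚ.+ + 1 ℚ./ E
fraction-≤ {t} {t′} n m e le = ℚ.toℚᵘ-cancel-≤ (begin
  ℚ.toℚᵘ (+ t′ ℚ./ M)                     ≃⟨ ℚ.toℚᵘ-fromℚᵘ (mkℚᵘ (+ t′) m) ⟩
  mkℚᵘ (+ t′) m                           ≤⟨ ℚᵘ.*≤* le′ ⟩
  mkℚᵘ (+ t) n ℚᵘ.+ mkℚᵘ (+ 1) e          ≃⟨ ℚᵘ.+-cong (ℚ.toℚᵘ-fromℚᵘ (mkℚᵘ (+ t) n)) (ℚ.toℚᵘ-fromℚᵘ (mkℚᵘ (+ 1) e)) ⟨
  ℚ.toℚᵘ (+ t ℚ./ N) ℚᵘ.+ ℚ.toℚᵘ (+ 1 ℚ./ E) ≃⟨ ℚ.toℚᵘ-homo-+ (+ t ℚ./ N) (+ 1 ℚ./ E) ⟨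
  ℚ.toℚᵘ (+ t ℚ./ N ℚ.+ + 1 ℚ./ E)        ∎)
  where
  open ℚᵘ.≤-Reasoning
  N = suc n
  M = suc m
  E = suc e
  le′ : + t′ ℤ.* + (N ℕ.* E) ℤ.≤ (+ t ℤ.* + E ℤ.+ + 1 ℤ.* + N) ℤ.* + M
  le′ = subst₂ ℤ._≤_ (ℤ.pos-* t′ (N ℕ.* E))
    (trans (ℤ.pos-* (t ℕ.* E ℕ.+ N) M) (cong (ℤ._* + M)
      (trans (ℤ.pos-+ (t ℕ.* E) N) (cong₂ ℤ._+_ (ℤ.pos-* t E) (sym (ℤ.*-identityˡ (+ N)))))))
    (ℤ.+≤+ le)

exponent-≤ : ∀ r s K-1 → let K = suc K-1 in s ℚ.≤ r ℚ.+ + 1 ℚ./ K →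
  (↥ s) ⁺ ℕ.* (↧ₙ r ℕ.* K) ℕ.+ (↥ r) ⁻ ℕ.* (↧ₙ s ℕ.* K) ℕ.≤
  (↥ r) ⁺ ℕ.* (↧ₙ s ℕ.* K) ℕ.+ (↥ s) ⁻ ℕ.* (↧ₙ r ℕ.* K) ℕ.+ ↧ₙ s ℕ.* ↧ₙ r
exponent-≤ r@(mkℚ p k-1 _) s@(mkℚ q l-1 _) K-1 le =
  ℤ.drop‿+≤+ (subst₂ ℤ._≤_ lhs rhs (ℤ.+-monoˡ-≤ (+ (q ⁻) ℤ.* kK ℤ.+ + (p ⁻) ℤ.* lK) le′))
  where
  K = suc K-1
  k = suc k-1
  l = suc l-1
  kK lK : ℤ
  kK = + k ℤ.* + K
  lK = + l ℤ.* + K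
  leᵘ : mkℚᵘ q l-1 ℚᵘ.≤ mkℚᵘ p k-1 ℚᵘ.+ mkℚᵘ (+ 1) K-1
  leᵘ = ℚᵘ.≤-trans (ℚ.toℚᵘ-mono-≤ le) (ℚᵘ.≤-reflexive (ℚᵘ.≃-trans (ℚ.toℚᵘ-homo-+ r (+ 1 ℚ./ K))
          (ℚᵘ.+-congʳ (mkℚᵘ p k-1) (ℚ.toℚᵘ-fromℚᵘ (mkℚᵘ (+ 1) K-1)))))
  le′ : q ℤ.* + (k ℕ.* K) ℤ.≤ (p ℤ.* + K ℤ.+ + 1 ℤ.* + k) ℤ.* + l
  le′ = ℚᵘ.drop-*≤* leᵘ
  open ℤ-Solver
  lhs : q ℤ.* + (k ℕ.* K) ℤ.+ (+ (q ⁻) ℤ.* kK ℤ.+ + (p ⁻) ℤ.* lK) ≡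
        + (q ⁺ ℕ.* (k ℕ.* K) ℕ.+ p ⁻ ℕ.* (l ℕ.* K))
  lhs = trans (cong₂ (λ z w → z ℤ.* w ℤ.+ (+ (q ⁻) ℤ.* kK ℤ.+ + (p ⁻) ℤ.* lK)) (⁺-⁻ q) (ℤ.pos-* k K))
    (trans (solve 4 (λ a b w v → (a :- b) :* w :+ (b :* w :+ v) := a :* w :+ v) refl
              (+ (q ⁺)) (+ (q ⁻)) kK (+ (p ⁻) ℤ.* lK))
    (sym (trans (ℤ.pos-+ (q ⁺ ℕ.* (k ℕ.* K)) _)
      (cong₂ ℤ._+_ (trans (ℤ.pos-* (q ⁺) (k ℕ.* K)) (cong (+ (q ⁺) ℤ.*_) (ℤ.pos-* k K)))
                   (trans (ℤ.pos-* (p ⁻) (l ℕ.* K)) (cong (+ (p ⁻) ℤ.*_) (ℤ.pos-* l K)))))))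
  rhs : (p ℤ.* + K ℤ.+ + 1 ℤ.* + k) ℤ.* + l ℤ.+ (+ (q ⁻) ℤ.* kK ℤ.+ + (p ⁻) ℤ.* lK) ≡
        + (p ⁺ ℕ.* (l ℕ.* K) ℕ.+ q ⁻ ℕ.* (k ℕ.* K) ℕ.+ l ℕ.* k)
  rhs = trans (cong (λ z → (z ℤ.* + K ℤ.+ + 1 ℤ.* + k) ℤ.* + l ℤ.+ (+ (q ⁻) ℤ.* kK ℤ.+ + (p ⁻) ℤ.* lK)) (⁺-⁻ p))
    (trans (solve 6 (λ a b c K k l → ((a :- b) :* K :+ con (+ 1) :* k) :* l :+ (c :* (k :* K) :+ b :* (l :* K))
                       := a :* (l :* K) :+ c :* (k :* K) :+ l :* k) refl
              (+ (p ⁺)) (+ (p ⁻)) (+ (q ⁻)) (+ K) (+ k) (+ l))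
    (sym (trans (ℤ.pos-+ (p ⁺ ℕ.* (l ℕ.* K) ℕ.+ q ⁻ ℕ.* (k ℕ.* K)) (l ℕ.* k))
      (cong₂ ℤ._+_ (trans (ℤ.pos-+ (p ⁺ ℕ.* (l ℕ.* K)) _)
        (cong₂ ℤ._+_ (trans (ℤ.pos-* (p ⁺) (l ℕ.* K)) (cong (+ (p ⁺) ℤ.*_) (ℤ.pos-* l K)))
                     (trans (ℤ.pos-* (q ⁻) (k ℕ.* K)) (cong (+ (q ⁻) ℤ.*_) (ℤ.pos-* k K)))))
        (ℤ.pos-* l k)))))

⁺≤∣∣ : ∀ z → z ⁺ ℕ.≤ ℤ.∣ z ∣
⁺≤∣∣ (+ n)    = ℕ.≤-refl
⁺≤∣∣ -[1+ n ] = z≤n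

⁻≤∣∣ : ∀ z → z ⁻ ℕ.≤ ℤ.∣ z ∣
⁻≤∣∣ (+ n)    = z≤n
⁻≤∣∣ -[1+ n ] = ℕ.≤-refl

∣↥∣-bound : ∀ {r b} → ∣ r ∣ ℚ.≤ b → ℤ.∣ ↥ r ∣ ℕ.≤ ℤ.∣ ↥ b ∣ ℕ.* ↧ₙ r
∣↥∣-bound {mkℚ p k-1 _} {mkℚ (+ b) d-1 _} (ℚ.*≤* le) = ℕ.≤-trans (ℕ.m≤m*n ℤ.∣ p ∣ (suc d-1))
  (ℤ.drop‿+≤+ (subst₂ ℤ._≤_ (sym (ℤ.pos-* ℤ.∣ p ∣ (suc d-1))) (sym (ℤ.pos-* b (suc k-1))) le))
∣↥∣-bound {mkℚ p k-1 _} { -[1+b]@(mkℚ -[1+ b ] d-1 _)} le =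
  ⊥-elim (ℚ.<-irrefl refl (ℚ.<-≤-trans (ℚ.negative⁻¹ -[1+b]) (ℚ.≤-trans (ℚ.0≤∣p∣ (mkℚ p k-1 _)) le)))

1/↧≤ : ∀ {ε} → 0ℚ ℚ.< ε → + 1 ℚ./ ↧ₙ ε ℚ.≤ ε
1/↧≤ {ε@(mkℚ (+ suc n) d _)} _ = ℚ.toℚᵘ-cancel-≤ (ℚᵘ.≤-respˡ-≃ (ℚᵘ.≃-sym (ℚ.toℚᵘ-fromℚᵘ (mkℚᵘ (+ 1) d)))
  (ℚᵘ.*≤* (ℤ.*-monoʳ-≤-nonNeg (+ suc d) {+ 1} {+ suc n} (ℤ.+≤+ (s≤s z≤n)))))
1/↧≤ {mkℚ (+ zero) d _} (ℚ.*<* (ℤ.+<+ ()))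
1/↧≤ {mkℚ -[1+ n ] d _} (ℚ.*<* ())

1/-pos : ∀ k → 0ℚ ℚ.< + 1 ℚ./ suc k
1/-pos k = ℚ.positive⁻¹ (+ 1 ℚ./ suc k) {{ℚ.normalize-pos 1 (suc k)}}

approx : ℕ → ℚ → ℕ → ℚ
approx n r i = + root n r (suc i) ℚ./ suc i

precision : ℕ → ℚ → ℕ → ℕ
precision n b E = 2 ℕ.* E ℕ.* n ℕ.* suc (n ℕ.^ ℤ.∣ ↥ b ∣)

approx-close : ∀ n .{{_ : ℕ.NonZero n}} b e r s i j → let E = suc e in
  ∣ r ∣ ℚ.≤ b → 2 ℕ.* E ℕ.≤ suc i →
  s ℚ.≤ r ℚ.+ + 1 ℚ./ suc (precision n b E) →
  approx n s j ℚ.≤ approx n r i ℚ.+ + 1 ℚ./ E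
approx-close n b e r s i j ∣r∣≤b 2E≤N s≤r+1/K = fraction-≤ {t} {t′} i j e (ℕ.*-cancelʳ-≤ _ _ (2 ℕ.* K) (begin
    t′ ℕ.* (N ℕ.* E) ℕ.* (2 ℕ.* K)
      ≡⟨ solve 4 (λ t N E K → t :* (N :* E) :* (con 2 :* K) := con 2 :* E :* (t :* (N :* K))) refl t′ N E K ⟩
    2 ℕ.* E ℕ.* (t′ ℕ.* (N ℕ.* K))
      ≤⟨ ℕ.*-monoʳ-≤ (2 ℕ.* E) t′NK≤ ⟩
    2 ℕ.* E ℕ.* (M ℕ.* (suc t ℕ.* (K ℕ.+ n)))
      ≡⟨ solve 5 (λ E M t K n → con 2 :* E :* (M :* ((con 1 :+ t) :* (K :+ n))) :=
           M :* (con 2 :* K :* (t :* E) :+ (con 2 :* E :* K :+ con 2 :* E :* n :* (con 1 :+ t)))) refl E M t K n ⟩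
    M ℕ.* (2 ℕ.* K ℕ.* (t ℕ.* E) ℕ.+ (2 ℕ.* E ℕ.* K ℕ.+ 2 ℕ.* E ℕ.* n ℕ.* suc t))
      ≤⟨ ℕ.*-monoʳ-≤ M (ℕ.+-monoʳ-≤ (2 ℕ.* K ℕ.* (t ℕ.* E)) (ℕ.+-mono-≤
           (ℕ.*-monoˡ-≤ K 2E≤N)
           (ℕ.*-monoʳ-≤ (2 ℕ.* E ℕ.* n) (ℕ.+-mono-≤ {1} {N} (s≤s z≤n) t≤)))) ⟩
    M ℕ.* (2 ℕ.* K ℕ.* (t ℕ.* E) ℕ.+ (N ℕ.* K ℕ.+ 2 ℕ.* E ℕ.* n ℕ.* (N ℕ.+ C ℕ.* N)))
      ≡⟨ solve 7 (λ M K t E N n C → M :* (con 2 :* K :* (t :* E) :+ (N :* K :+ con 2 :* E :* n :* (N :+ C :* N))) :=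
           M :* (con 2 :* K :* (t :* E) :+ (N :* K :+ N :* (con 2 :* E :* n :* (con 1 :+ C))))) refl M K t E N n C ⟩
    M ℕ.* (2 ℕ.* K ℕ.* (t ℕ.* E) ℕ.+ (N ℕ.* K ℕ.+ N ℕ.* precision n b E))
      ≤⟨ ℕ.*-monoʳ-≤ M (ℕ.+-monoʳ-≤ (2 ℕ.* K ℕ.* (t ℕ.* E)) (ℕ.+-monoʳ-≤ (N ℕ.* K) (ℕ.*-monoʳ-≤ N (ℕ.n≤1+n (precision n b E))))) ⟩
    M ℕ.* (2 ℕ.* K ℕ.* (t ℕ.* E) ℕ.+ (N ℕ.* K ℕ.+ N ℕ.* K))
      ≡⟨ solve 5 (λ M K t E N → M :* (con 2 :* K :* (t :* E) :+ (N :* K :+ N :* K)) :=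
           (t :* E :+ N) :* M :* (con 2 :* K)) refl M K t E N ⟩
    (t ℕ.* E ℕ.+ N) ℕ.* M ℕ.* (2 ℕ.* K) ∎))
  where
  open ℕ.≤-Reasoning
  open ℕ-Solver
  B = ℤ.∣ ↥ b ∣
  C = n ℕ.^ B
  E = suc e
  K = suc (precision n b E)
  N = suc i
  M = suc j
  t = root n r N
  t′ = root n s M
  t≤ : t ℕ.≤ C ℕ.* N
  t≤ = pow-upper n (↧ₙ r) {(↥ r) ⁺} {(↥ r) ⁻} {N} {t} {B} (root-sound n r N)
         (ℕ.≤-trans (⁺≤∣∣ (↥ r)) (∣↥∣-bound {r} ∣r∣≤b))
  t′NK≤ : t′ ℕ.* (N ℕ.* K) ℕ.≤ M ℕ.* (suc t ℕ.* (K ℕ.+ n))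
  t′NK≤ = modulus n (↧ₙ r) (↧ₙ s) K {(↥ r) ⁺} {(↥ r) ⁻} {(↥ s) ⁺} {(↥ s) ⁻} {N} {M} {suc t} {t′}
    (root-maximal n r N) (root-sound n s M) (exponent-≤ r s (precision n b E) s≤r+1/K)

-- Real powers of natural numbers: degrees and NK* are the only bases used.  For
-- n ≥ 1 the i-th term is n ^ (seq a i) rounded down to a multiple of 1/(i+1).
-- 0 ^ a = 0 is the usual value when a > 0, and a junk value otherwise.
infixr 8 _^ᵣ_

_^ᵣ_ : ℕ → ℝ → ℝ
zero      ^ᵣ a = 0ᵣ
n@(suc _) ^ᵣ a = mkℝ (λ i → approx n (seq a i) i) λ ε ε>0 →
  let b , _ , N₁ , ∣a∣≤b = bounded a
      E = ↧ₙ ε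
      K = precision n b E
      N₂ , hK = cauchy a (+ 1 ℚ./ suc K) (1/-pos K)
      N = N₁ ℕ.⊔ N₂ ℕ.⊔ (2 ℕ.* E)
      N₁≤N = ℕ.≤-trans (ℕ.m≤m⊔n N₁ N₂) (ℕ.m≤m⊔n (N₁ ℕ.⊔ N₂) (2 ℕ.* E))
      N₂≤N = ℕ.≤-trans (ℕ.m≤n⊔m N₁ N₂) (ℕ.m≤m⊔n (N₁ ℕ.⊔ N₂) (2 ℕ.* E))
      close : ∀ i j → N ℕ.≤ i → N ℕ.≤ j → approx n (seq a j) j ℚ.≤ approx n (seq a i) i ℚ.+ ε
      close i j N≤i N≤j = ℚ.≤-trans
        (approx-close n b (ℚ.ℚ.denominator-1 ε) (seq a i) (seq a j) i j
          (∣a∣≤b i (ℕ.≤-trans N₁≤N N≤i))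
          (ℕ.m≤n⇒m≤1+n (ℕ.≤-trans (ℕ.m≤n⊔m (N₁ ℕ.⊔ N₂) (2 ℕ.* E)) N≤i))
          (p-q≤ε⇒p≤q+ε (ℚ.≤-trans (p≤∣p∣ (seq a j ℚ.- seq a i)) (hK j i (ℕ.≤-trans N₂≤N N≤j) (ℕ.≤-trans N₂≤N N≤i)))))
        (ℚ.+-monoʳ-≤ (approx n (seq a i) i) (1/↧≤ ε>0))
  in N , λ i j N≤i N≤j → abs-≤
       (p≤q+ε⇒p-q≤ε (close j i N≤j N≤i))
       (subst (ℚ._≤ ε) (sym (-[p-q] (approx n (seq a i) i) (approx n (seq a j) j)))
         (p≤q+ε⇒p-q≤ε (close i j N≤i N≤j)))
  where
  open ℚ-Solver
  -[p-q] : ∀ p q → ℚ.- (p ℚ.- q) ≡ q ℚ.- p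
  -[p-q] = solve 2 (λ p q → :- (p :- q) := q :- p) refl

^ᵣ-pos : ∀ {n} a → 0 ℕ.< n → 0ᵣ <ᵣ n ^ᵣ a
^ᵣ-pos {n@(suc _)} a _ =
  let b , _ , N₁ , ∣a∣≤b = bounded a
      C = n ℕ.^ ℤ.∣ ↥ b ∣
  in *<* (+ 1 ℚ./ suc (2 ℕ.* C) , 1/-pos (2 ℕ.* C) , N₁ ℕ.⊔ (2 ℕ.* C) , λ i N≤i →
    let t = root n (seq a i) (suc i)
        s≤ = pow-lower n (↧ₙ (seq a i)) {(↥ (seq a i)) ⁺} {(↥ (seq a i)) ⁻} {suc i} {suc t} {ℤ.∣ ↥ b ∣}
               (root-maximal n (seq a i) (suc i))
               (ℕ.≤-trans (⁻≤∣∣ (↥ (seq a i)))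
                 (∣↥∣-bound {seq a i} (∣a∣≤b i (ℕ.≤-trans (ℕ.m≤m⊔n N₁ (2 ℕ.* C)) N≤i))))
        2C≤ = ℕ.m≤n⇒m≤1+n (ℕ.≤-trans (ℕ.m≤n⊔m N₁ (2 ℕ.* C)) N≤i)
    in ℚ.≤-trans (ℚ.≤-reflexive (ℚ.+-identityˡ (+ 1 ℚ./ suc (2 ℕ.* C))))
         (unit-fraction-≤ t i (2 ℕ.* C) (lower C t (suc i) s≤ 2C≤)))
  where
  lower : ∀ C t N → N ℕ.≤ suc t ℕ.* C → 2 ℕ.* C ℕ.≤ N → N ℕ.≤ t ℕ.* suc (2 ℕ.* C)
  lower C t N h₁ h₂ = ℕ.≤-trans (ℕ.+-cancelʳ-≤ N N (t ℕ.* (2 ℕ.* C)) (begin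
    N ℕ.+ N                          ≤⟨ ℕ.+-mono-≤ h₁ h₁ ⟩
    suc t ℕ.* C ℕ.+ suc t ℕ.* C      ≡⟨ solve 2 (λ t C → (con 1 :+ t) :* C :+ (con 1 :+ t) :* C
                                          := t :* (con 2 :* C) :+ con 2 :* C) refl t C ⟩
    t ℕ.* (2 ℕ.* C) ℕ.+ 2 ℕ.* C      ≤⟨ ℕ.+-monoʳ-≤ (t ℕ.* (2 ℕ.* C)) h₂ ⟩
    t ℕ.* (2 ℕ.* C) ℕ.+ N            ∎)) (ℕ.*-monoʳ-≤ t (ℕ.n≤1+n (2 ℕ.* C)))
    where
    open ℕ.≤-Reasoning
    open ℕ-Solver
  unit-fraction-≤ : ∀ t n d → suc n ℕ.≤ t ℕ.* suc d → + 1 ℚ./ suc d ℚ.≤ + t ℚ./ suc n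
  unit-fraction-≤ t n d le = ℚ.toℚᵘ-cancel-≤
    (ℚᵘ.≤-respˡ-≃ (ℚᵘ.≃-sym (ℚ.toℚᵘ-fromℚᵘ (mkℚᵘ (+ 1) d)))
    (ℚᵘ.≤-respʳ-≃ (ℚᵘ.≃-sym (ℚ.toℚᵘ-fromℚᵘ (mkℚᵘ (+ t) n)))
    (ℚᵘ.*≤* (subst₂ ℤ._≤_ (sym (ℤ.*-identityˡ (+ suc n))) (ℤ.pos-* t (suc d)) (ℤ.+≤+ le)))))

fromℕ-pos : ∀ {n} → 0 ℕ.< n → 0ᵣ <ᵣ fromℕ n
fromℕ-pos {suc n} _ = *<* (1ℚ , ℚ.positive⁻¹ 1ℚ , 0 , λ _ _ → ℚ.toℚᵘ-cancel-≤
  (ℚᵘ.≤-respʳ-≃ (ℚᵘ.≃-sym (ℚ.toℚᵘ-fromℚᵘ (mkℚᵘ (+ suc n) 0)))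
    (ℚᵘ.*≤* (ℤ.*-monoʳ-≤-nonNeg (+ 1) {+ 1} {+ suc n} (ℤ.+≤+ (s≤s z≤n))))))

record Graph (n : ℕ) : Set₁ where
  field
    Adj    : Rel (Fin n) 0ℓ
    adj?   : B.Decidable Adj
    symm   : Symmetric Adj
    irrefl : Irreflexive _≡_ Adj

module _ {n : ℕ} (G : Graph n) where
  open Graph G

  degree : Fin n → ℕ
  degree u = length (filter (adj? u) (allFin n))

  -- Each edge is listed once, as the pair of its endpoints in increasing order.
  IsEdge : Fin n × Fin n → Set
  IsEdge (u , v) = u Fin.< v × Adj u v

  isEdge? : Decidable IsEdge
  isEdge? (u , v) = (u Fin.<? v) ×-dec adj? u v

  vertexPairs : List (Fin n × Fin n)
  vertexPairs = cartesianProduct (allFin n) (allFin n)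

  edges : List (Fin n × Fin n)
  edges = filter isEdge? vertexPairs

  size : ℕ
  size = length edges

  IsMinDegree : ℕ → Set
  IsMinDegree δ = (∀ u → δ ℕ.≤ degree u) × ∃ λ u → degree u ≡ δ

  Regular : Set
  Regular = ∀ u v → degree u ≡ degree v

  NK* : ℕ
  NK* = product (map (λ u → degree u ℕ.^ degree u) (allFin n))

  degree-pos : ∀ {u v} → Adj u v → 0 ℕ.< degree u
  degree-pos {u} {v} u~v = ∈-length (∈-filter⁺ (adj? u) (∈-allFin v) u~v)

  sddTerm : ℝ → ∀ {uv} → IsEdge uv → ℝ
  sddTerm α {u , v} (_ , u~v) =
    (degree u ^ᵣ α) /ᵣ (degree v ^ᵣ α) [ ^ᵣ-pos α (degree-pos (symm u~v)) ] +ᵣ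
    (degree v ^ᵣ α) /ᵣ (degree u ^ᵣ α) [ ^ᵣ-pos α (degree-pos u~v) ]

  SDD : ℝ → ℝ
  SDD α = foldr _+ᵣ_ 0ᵣ (reduce (sddTerm α) (all-filter isEdge? vertexPairs))

{-# OPTIONS --safe #-}
-- Every term x/y + y/x of SDD_α is at least 2, so SDD_α ≥ 2m, with equality for a regular graph.  The
-- claimed bound is 2m · δ^(2α) NK*^(-α/m), and by the handshake lemma δ^(2m) = ∏ δ^(d_u) ≤ ∏ d_u^(d_u) = NK*,
-- strictly unless every degree is δ; hence the bound is at most 2m, and less than 2m if G is not regular.
-- Since 2α = 2m · (α/m), comparing the real powers reduces to comparing δ^(2m) with NK*, and this is done
-- on the rational approximations of the powers, by clearing all roots.
module Submission where

open import Data.Empty using (⊥; ⊥-elim)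
open import Data.Fin as Fin using (Fin)
import Data.Fin.Properties as Fin
open import Data.Integer as ℤ using (+_; -[1+_])
import Data.Integer.Properties as ℤ
open import Data.List using (List; []; _∷_; allFin; cartesianProduct; filter; foldr; length; map)
open import Data.List.Membership.Propositional using (_∈_)
open import Data.List.Membership.Propositional.Properties using (∈-allFin)
open import Data.List.Properties using (filter-++; filter-≐; length-++; map-cong)
open import Data.List.Relation.Unary.All using (All; []; _∷_; reduce)
open import Data.List.Relation.Unary.All.Properties using (all-filter)
open import Data.List.Relation.Unary.Any using (here; there)
open import Data.Nat as ℕ using (ℕ; zero; suc; s≤s; z≤n; _≤_)
open import Data.Nat.ListAction using (product; sum)
import Data.Nat.Properties as ℕ
open import Data.Product using (∃; _×_; _,_; proj₁; proj₂)
open import Data.Rational as ℚ using (ℚ; mkℚ; ↥_; ↧ₙ_; 0ℚ; 1ℚ; ½; ∣_∣)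
import Data.Rational.Properties as ℚ
open import Data.Rational.Unnormalised as ℚᵘ using (mkℚᵘ)
import Data.Rational.Unnormalised.Properties as ℚᵘ
open import Data.Sum using (_⊎_; inj₁; inj₂)
open import Function using (_∘_)
open import Function.Bundles using (_⇔_; mk⇔)
open import Level using (0ℓ)
open import Relation.Binary using (tri<; tri≈; tri>)
open import Relation.Binary.PropositionalEquality
open import Relation.Nullary using (¬_; Dec; yes; no)
open import Relation.Nullary.Decidable using (_×-dec_)
open import Relation.Unary using (Decidable; Pred)
open import Defs

-- A strict inequality between Cauchy reals needs one rational gap valid at all late indices, while
-- `α/m` is known only through approximations. What is available is an eventual lower bound `θ` of
-- `α/m`, and `θ ≥ 1/E` for its denominator `E`. Since `δ^(2m) / NK*` is at most 1, lowering the
-- exponent only enlarges the power, so an `E`-th root suffices: for naturals `a < n`, Bernoulli's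
-- inequality bounds the `E`-th root of `a/n` by `1 - 1/(nE)`, which is the source of the gap. Real
-- arithmetic is termwise, so at each index the two rational exponents are in the exact ratio
-- `2m : -1`, and the powers are compared index by index without any continuity of powers. Rounding
-- down is harmless for the upper bound; in the regular case it costs one unit `1/(i+1)` per factor,
-- which vanishes in the limit.

-- Natural powers

module NaturalPowers where
  open import Data.Nat
  open import Data.Nat.Properties
  open ℕ-Solver

  ^-exponents : ∀ b x y {z} → x * y ≡ z → (b ^ x) ^ y ≡ b ^ z
  ^-exponents b x y eq = trans (^-*-assoc b x y) (cong (b ^_) eq)

  raise : ∀ {a b c} e → a ≤ b * c → a ^ e ≤ b ^ e * c ^ e
  raise {b = b} {c} e le = ≤-trans (^-monoˡ-≤ e le) (≤-reflexive (^-*-distrib b c e))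

  -- The real inequality behind it: if τ ≤ d^(a/k), τ′ ≤ n^(-c/l), a/k = j c/l and
  -- d^j / n ≤ (x/y)^E ≤ 1 with E ≥ l/c, then τ τ′ ≤ (d^j / n)^(c/l) ≤ x/y.
  root-product-upper : ∀ {t t′ d n a c j x y E M M′} k l
    .{{_ : NonZero k}} .{{_ : NonZero l}} .{{_ : NonZero n}} .{{_ : NonZero y}} →
    t ^ k ≤ d ^ a * M ^ k → t′ ^ l * n ^ c ≤ M′ ^ l → a * l ≡ j * (c * k) →
    d ^ j * y ^ E ≤ n * x ^ E → x ≤ y → l ≤ E * c →
    t * t′ * y ≤ x * (M * M′)
  root-product-upper {t} {t′} {d} {n} {a} {c} {j} {x} {y} {E} {M} {M′} k l ht ht′ eq gap x≤y l≤Ec =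
    -- The power `e = k * l` clears both roots, `n ^ (c * k)` absorbs the negative exponent, and
    -- `y ^ r` pads `y ^ e` to the exponent at which `gap′` applies. Afterwards `x ≤ y` turns the
    -- surplus `x ^ r` back into the padding.
    ^-cancelʳ-≤ e {{m*n≢0 k l}} (*-cancelʳ-≤ _ _ (n ^ (c * k) * y ^ r) {{m*n≢0 _ _ {{m^n≢0 n (c * k)}} {{m^n≢0 y r}}}} (begin
      (t * t′ * y) ^ e * (n ^ (c * k) * y ^ r)
        ≡⟨ cong (_* (n ^ (c * k) * y ^ r)) (trans (^-*-distrib (t * t′) y e) (cong (_* y ^ e) (^-*-distrib t t′ e))) ⟩
      t ^ e * t′ ^ e * y ^ e * (n ^ (c * k) * y ^ r)
        ≡⟨ solve 5 (λ t t′ y n z → t :* t′ :* y :* (n :* z) := t :* (t′ :* n) :* (y :* z))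
            refl (t ^ e) (t′ ^ e) (y ^ e) (n ^ (c * k)) (y ^ r) ⟩
      t ^ e * (t′ ^ e * n ^ (c * k)) * (y ^ e * y ^ r)
        ≤⟨ *-mono-≤ (*-mono-≤ hT hT′) (≤-reflexive (trans (sym (^-distribˡ-+-* y e r)) (cong (y ^_) e+r))) ⟩
      d ^ (j * (c * k)) * M ^ e * M′ ^ e * y ^ (E * (c * k))
        ≡⟨ solve 4 (λ d M M′ y → d :* M :* M′ :* y := M :* M′ :* (d :* y))
            refl (d ^ (j * (c * k))) (M ^ e) (M′ ^ e) _ ⟩
      M ^ e * M′ ^ e * (d ^ (j * (c * k)) * y ^ (E * (c * k)))
        ≤⟨ *-monoʳ-≤ (M ^ e * M′ ^ e) gap′ ⟩
      M ^ e * M′ ^ e * (n ^ (c * k) * x ^ (E * (c * k)))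
        ≡⟨ cong (λ z → M ^ e * M′ ^ e * (n ^ (c * k) * z)) (trans (cong (x ^_) (sym e+r)) (^-distribˡ-+-* x e r)) ⟩
      M ^ e * M′ ^ e * (n ^ (c * k) * (x ^ e * x ^ r))
        ≤⟨ *-monoʳ-≤ (M ^ e * M′ ^ e) (*-monoʳ-≤ (n ^ (c * k)) (*-monoʳ-≤ (x ^ e) (^-monoˡ-≤ r x≤y))) ⟩
      M ^ e * M′ ^ e * (n ^ (c * k) * (x ^ e * y ^ r))
        ≡⟨ solve 5 (λ M M′ n x y → M :* M′ :* (n :* (x :* y)) := x :* (M :* M′) :* (n :* y))
            refl (M ^ e) (M′ ^ e) (n ^ (c * k)) (x ^ e) (y ^ r) ⟩
      x ^ e * (M ^ e * M′ ^ e) * (n ^ (c * k) * y ^ r)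
        ≡⟨ cong (_* (n ^ (c * k) * y ^ r)) (trans (^-*-distrib x (M * M′) e) (cong (x ^ e *_) (^-*-distrib M M′ e))) ⟨
      (x * (M * M′)) ^ e * (n ^ (c * k) * y ^ r) ∎))
    where
    open ≤-Reasoning
    e = k * l
    r = E * (c * k) ∸ e
    e≤ : e ≤ E * (c * k)
    e≤ = subst (e ≤_) (solve 3 (λ k E c → k :* (E :* c) := E :* (c :* k)) refl k E c) (*-monoʳ-≤ k l≤Ec)
    e+r : e + r ≡ E * (c * k)
    e+r = m+[n∸m]≡n e≤
    hT : t ^ e ≤ d ^ (j * (c * k)) * M ^ e
    hT = subst₂ _≤_ (^-*-assoc t k l) (cong₂ _*_ (^-exponents d a l eq) (^-*-assoc M k l)) (raise l ht)
    hT′ : t′ ^ e * n ^ (c * k) ≤ M′ ^ e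
    hT′ = subst₂ _≤_
      (trans (^-*-distrib (t′ ^ l) (n ^ c) k) (cong₂ _*_ (^-exponents t′ l k (*-comm l k)) (^-*-assoc n c k)))
      (^-exponents M′ l k (*-comm l k)) (^-monoˡ-≤ k ht′)
    gap′ : d ^ (j * (c * k)) * y ^ (E * (c * k)) ≤ n ^ (c * k) * x ^ (E * (c * k))
    gap′ = subst₂ _≤_
      (trans (^-*-distrib (d ^ j) (y ^ E) (c * k)) (cong₂ _*_ (^-*-assoc d j (c * k)) (^-*-assoc y E (c * k))))
      (cong (n ^ (c * k) *_) (^-*-assoc x E (c * k)))
      (raise (c * k) gap)

  -- For `n = d^j` and `a/k = j c/l` the powers `d^(a/k)` and `n^(-c/l)` are reciprocal. As `T / M`
  -- and `T′ / M′` over-estimate them, the product of these quotients is at least 1.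
  root-product-lower : ∀ {T T′ d n a c j M M′} k l .{{_ : NonZero k}} .{{_ : NonZero l}} .{{_ : NonZero d}} →
    d ^ a * M ^ k ≤ T ^ k → M′ ^ l ≤ T′ ^ l * n ^ c → a * l ≡ j * (c * k) → n ≡ d ^ j →
    M * M′ ≤ T * T′
  root-product-lower {T} {T′} {d} {n} {a} {c} {j} {M} {M′} k l hT hT′ eq refl =
    ^-cancelʳ-≤ e {{m*n≢0 k l}} (*-cancelʳ-≤ _ _ D {{m^n≢0 d (j * (c * k))}} (begin
      (M * M′) ^ e * D      ≡⟨ cong (_* D) (^-*-distrib M M′ e) ⟩
      M ^ e * M′ ^ e * D    ≡⟨ solve 3 (λ x y z → x :* y :* z := z :* x :* y) refl (M ^ e) (M′ ^ e) D ⟩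
      D * M ^ e * M′ ^ e    ≤⟨ *-mono-≤ hM hM′ ⟩
      T ^ e * (T′ ^ e * D)  ≡⟨ *-assoc (T ^ e) (T′ ^ e) D ⟨
      T ^ e * T′ ^ e * D    ≡⟨ cong (_* D) (^-*-distrib T T′ e) ⟨
      (T * T′) ^ e * D      ∎))
    where
    open ≤-Reasoning
    e = k * l
    D = d ^ (j * (c * k))
    hM : D * M ^ e ≤ T ^ e
    hM = subst₂ _≤_
      (trans (^-*-distrib (d ^ a) (M ^ k) l) (cong₂ _*_ (^-exponents d a l eq) (^-*-assoc M k l)))
      (^-*-assoc T k l) (^-monoˡ-≤ l hT)
    hM′ : M′ ^ e ≤ T′ ^ e * D
    hM′ = subst₂ _≤_ (^-exponents M′ l k (*-comm l k))
      (cong₂ _*_ (^-exponents T′ l k (*-comm l k))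
        (trans (^-*-assoc (d ^ j) c k) (^-*-assoc d j (c * k))))
      (raise k hT′)

  -- (1 - 1/(x+1))^e ≥ 1 - e/(x+1), multiplied out.
  bernoulli-decreasing : ∀ x e → suc x ^ e * suc x ≤ x ^ e * suc x + e * suc x ^ e
  bernoulli-decreasing x zero    = ≤-reflexive (sym (+-identityʳ _))
  bernoulli-decreasing x (suc e) = begin
    y * y ^ e * y                              ≡⟨ *-assoc y (y ^ e) y ⟩
    y * (y ^ e * y)                            ≤⟨ *-monoʳ-≤ y (bernoulli-decreasing x e) ⟩
    y * (x ^ e * y + e * y ^ e)
      ≡⟨ solve 4 (λ x p q e → (con 1 :+ x) :* (p :* (con 1 :+ x) :+ e :* q) :=
           x :* p :* (con 1 :+ x) :+ (p :* (con 1 :+ x) :+ e :* ((con 1 :+ x) :* q))) refl x (x ^ e) (y ^ e) e ⟩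
    x * x ^ e * y + (x ^ e * y + e * (y * y ^ e))
      ≤⟨ +-monoʳ-≤ (x * x ^ e * y) (+-monoˡ-≤ _ (subst (x ^ e * y ≤_) (*-comm (y ^ e) y)
          (*-monoˡ-≤ y (^-monoˡ-≤ e (n≤1+n x))))) ⟩
    x * x ^ e * y + suc e * y ^ suc e          ∎
    where
    open ≤-Reasoning
    y = suc x

  -- 1 - 1/(n E) is at least the E-th root of 1 - 1/n.
  root-gap : ∀ {a n x} E .{{_ : NonZero E}} → a < n → suc x ≡ n * E → a * suc x ^ E ≤ n * x ^ E
  -- Bernoulli reads `x^E (x+1) ≥ (x+1)^E (x+1-E)`, and `x+1 = nE` makes the last factor
  -- `(n-1)E ≥ aE`. Adding `E * Y` to both sides avoids the subtraction.
  root-gap {a} {n} {x} E a<n eq = *-cancelʳ-≤ _ _ E (+-cancelʳ-≤ (E * Y) _ _ (begin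
    a * Y * E + E * Y        ≡⟨ solve 3 (λ a Y E → a :* Y :* E :+ E :* Y := Y :* ((con 1 :+ a) :* E)) refl a Y E ⟩
    Y * (suc a * E)          ≤⟨ *-monoʳ-≤ Y (*-monoˡ-≤ E a<n) ⟩
    Y * (n * E)              ≡⟨ cong (Y *_) eq ⟨
    Y * suc x                ≤⟨ bernoulli-decreasing x E ⟩
    x ^ E * suc x + E * Y    ≡⟨ cong (λ z → x ^ E * z + E * Y) eq ⟩
    x ^ E * (n * E) + E * Y  ≡⟨ cong (_+ E * Y) (solve 3 (λ X n E → X :* (n :* E) := n :* X :* E) refl (x ^ E) n E) ⟩
    n * x ^ E * E + E * Y    ∎))
    where
    open ≤-Reasoning
    Y = suc x ^ E

open NaturalPowers

-- Degrees and the Narumi-Katayama index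

module Degrees where
  open import Data.Nat
  open import Data.Nat.Properties

  module _ {A : Set} where
    count : {P : Pred A 0ℓ} → Decidable P → List A → ℕ
    count P? xs = length (filter P? xs)

    -- The head is kept as a singleton list so that the split can be used under a binder, where
    -- `P? x` cannot be case-analysed.
    count-∷ : ∀ {P : Pred A 0ℓ} (P? : Decidable P) x xs → count P? (x ∷ xs) ≡ count P? (x ∷ []) + count P? xs
    count-∷ P? x xs = trans (cong length (filter-++ P? (x ∷ []) xs)) (length-++ (filter P? (x ∷ [])))

    count-map : ∀ {B : Set} {P : Pred B 0ℓ} (P? : Decidable P) (f : A → B) xs →
        count (P? ∘ f) xs ≡ length (filter P? (map f xs))
    count-map P? f [] = refl
    count-map P? f (x ∷ xs) with P? (f x)
    ... | yes _ = cong suc (count-map P? f xs)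
    ... | no  _ = count-map P? f xs

    count-⊎ : ∀ {P Q R : Pred A 0ℓ} (P? : Decidable P) (Q? : Decidable Q) (R? : Decidable R) →
      (∀ {x} → P x → Q x ⊎ R x) → (∀ {x} → Q x → P x) → (∀ {x} → R x → P x) → (∀ {x} → Q x → ¬ R x) →
      ∀ xs → count P? xs ≡ count Q? xs + count R? xs
    count-⊎ P? Q? R? split Q⇒P R⇒P disjoint [] = refl
    count-⊎ P? Q? R? split Q⇒P R⇒P disjoint (x ∷ xs)
      with ih ← count-⊎ P? Q? R? split Q⇒P R⇒P disjoint xs | P? x | Q? x | R? x
    ... | yes _ | yes q | yes r = ⊥-elim (disjoint q r)
    ... | yes _ | yes _ | no  _ = cong suc ih
    ... | yes _ | no  _ | yes _ = trans (cong suc ih) (sym (+-suc _ _))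
    ... | yes p | no ¬q | no ¬r with split p
    ...   | inj₁ q = ⊥-elim (¬q q)
    ...   | inj₂ r = ⊥-elim (¬r r)
    count-⊎ P? Q? R? split Q⇒P R⇒P disjoint (x ∷ xs) | no ¬p | yes q | _     = ⊥-elim (¬p (Q⇒P q))
    count-⊎ P? Q? R? split Q⇒P R⇒P disjoint (x ∷ xs) | no ¬p | no  _ | yes r = ⊥-elim (¬p (R⇒P r))
    count-⊎ P? Q? R? split Q⇒P R⇒P disjoint (x ∷ xs) | no ¬p | no  _ | no  _ = ih

    sum-map-+ : ∀ (f g : A → ℕ) xs → sum (map (λ x → f x + g x) xs) ≡ sum (map f xs) + sum (map g xs)
    sum-map-+ f g []       = refl
    sum-map-+ f g (x ∷ xs) = trans (cong (λ z → f x + g x + z) (sum-map-+ f g xs))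
      (ℕ-Solver.solve 4 (λ a b c d → a :+ b :+ (c :+ d) := a :+ c :+ (b :+ d)) refl (f x) (g x) _ _)
      where open ℕ-Solver

    sum-map-0 : ∀ (xs : List A) → sum (map (λ _ → 0) xs) ≡ 0
    sum-map-0 []       = refl
    sum-map-0 (_ ∷ xs) = sum-map-0 xs

    ^-sum : ∀ d (f : A → ℕ) xs → d ^ sum (map f xs) ≡ product (map (λ x → d ^ f x) xs)
    ^-sum d f []       = refl
    ^-sum d f (x ∷ xs) = trans (^-distribˡ-+-* d (f x) _) (cong (d ^ f x *_) (^-sum d f xs))

    product-pos : ∀ {f : A → ℕ} → (∀ x → 0 < f x) → ∀ xs → 0 < product (map f xs)
    product-pos f>0 []       = z<s
    product-pos f>0 (x ∷ xs) = *-mono-≤ (f>0 x) (product-pos f>0 xs)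

    module _ {f g : A → ℕ} (f≤g : ∀ x → f x ≤ g x) where
      product-mono-≤ : ∀ xs → product (map f xs) ≤ product (map g xs)
      product-mono-≤ []       = ≤-refl
      product-mono-≤ (x ∷ xs) = *-mono-≤ (f≤g x) (product-mono-≤ xs)

      -- A zero factor elsewhere in the larger product would absorb the strict inequality, hence the
      -- positivity of every `g x`.
      product-mono-< : (∀ x → 0 < g x) → ∀ {x xs} → x ∈ xs → f x < g x → product (map f xs) < product (map g xs)
      product-mono-< g>0 {x} {_ ∷ xs} (here refl) fx<gx = ≤-<-trans
        (*-monoʳ-≤ (f x) (product-mono-≤ xs))
        (*-monoˡ-< _ {{>-nonZero (product-pos g>0 xs)}} fx<gx)
      product-mono-< g>0 {xs = y ∷ xs} (there x∈xs) fx<gx = ≤-<-trans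
        (*-monoˡ-≤ (product (map f xs)) (f≤g y))
        (*-monoʳ-< (g y) {{>-nonZero (g>0 y)}} (product-mono-< g>0 x∈xs fx<gx))

  module _ {A B : Set} {P : Pred (A × B) 0ℓ} (P? : Decidable P) where
    count-cartesianProduct : ∀ xs ys →
      count P? (cartesianProduct xs ys) ≡ sum (map (λ x → count (λ y → P? (x , y)) ys) xs)
    count-cartesianProduct []       ys = refl
    count-cartesianProduct (x ∷ xs) ys =
      trans (cong length (filter-++ P? (map (x ,_) ys) (cartesianProduct xs ys)))
      (trans (length-++ (filter P? (map (x ,_) ys)))
        (cong₂ _+_ (sym (count-map P? (x ,_) ys)) (count-cartesianProduct xs ys)))

    sum-count-swap : ∀ xs ys →
      sum (map (λ x → count (λ y → P? (x , y)) ys) xs) ≡ sum (map (λ y → count (λ x → P? (x , y)) xs) ys)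
    sum-count-swap xs []       = sum-map-0 xs
    sum-count-swap xs (y ∷ ys) = begin
      sum (map (λ x → count (λ y → P? (x , y)) (y ∷ ys)) xs)
        ≡⟨ cong sum (map-cong (λ x → count-∷ (λ y → P? (x , y)) y ys) xs) ⟩
      sum (map (λ x → count (λ y → P? (x , y)) (y ∷ []) + count (λ y → P? (x , y)) ys) xs)
        ≡⟨ sum-map-+ (λ x → count (λ y → P? (x , y)) (y ∷ [])) _ xs ⟩
      sum (map (λ x → count (λ y → P? (x , y)) (y ∷ [])) xs) + sum (map (λ x → count (λ y → P? (x , y)) ys) xs)
        ≡⟨ cong₂ _+_ (column xs) (sum-count-swap xs ys) ⟩
      count (λ x → P? (x , y)) xs + sum (map (λ y → count (λ x → P? (x , y)) xs) ys) ∎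
      where
      open ≡-Reasoning
      column : ∀ xs → sum (map (λ x → count (λ y → P? (x , y)) (y ∷ [])) xs) ≡ count (λ x → P? (x , y)) xs
      column []       = refl
      column (x ∷ xs) with P? (x , y)
      ... | yes _ = cong suc (column xs)
      ... | no  _ = column xs

  module _ {n : ℕ} (G : Graph n) where
    open Graph G

    -- Each neighbour of `u` lies above or below `u` in the vertex order. The upward pairs are
    -- exactly the listed edges; exchanging the order of summation turns the downward pairs into
    -- upward ones.
    handshake : sum (map (degree G) (allFin n)) ≡ 2 * size G
    handshake = begin
      sum (map (degree G) (allFin n))
        ≡⟨ cong sum (map-cong degree-split (allFin n)) ⟩
      sum (map (λ u → count (up? u) (allFin n) + count (down? u) (allFin n)) (allFin n))
        ≡⟨ sum-map-+ (λ u → count (up? u) (allFin n)) _ (allFin n) ⟩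
      sum (map (λ u → count (up? u) (allFin n)) (allFin n)) + sum (map (λ u → count (down? u) (allFin n)) (allFin n))
        ≡⟨ cong₂ _+_ ups≡size (trans (sum-count-swap (λ (u , v) → down? u v) (allFin n) (allFin n))
             (trans (cong sum (map-cong down≡up (allFin n))) ups≡size)) ⟩
      size G + size G
        ≡⟨ cong (λ z → size G + z) (+-identityʳ (size G)) ⟨
      2 * size G ∎
      where
      open ≡-Reasoning
      up? : ∀ u v → Dec (u Fin.< v × Adj u v)
      up? u v = (u Fin.<? v) ×-dec adj? u v
      down? : ∀ u v → Dec (v Fin.< u × Adj u v)
      down? u v = (v Fin.<? u) ×-dec adj? u v
      degree-split : ∀ u → degree G u ≡ count (up? u) (allFin n) + count (down? u) (allFin n)
      degree-split u = count-⊎ (adj? u) (up? u) (down? u) split proj₂ proj₂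
        (λ (u<v , _) (v<u , _) → <-asym u<v v<u) (allFin n)
        where
        split : ∀ {v} → Adj u v → u Fin.< v × Adj u v ⊎ v Fin.< u × Adj u v
        split {v} u~v with Fin.<-cmp u v
        ... | tri< u<v _ _ = inj₁ (u<v , u~v)
        ... | tri≈ _ u≡v _ = ⊥-elim (irrefl u≡v u~v)
        ... | tri> _ _ v<u = inj₂ (v<u , u~v)
      down≡up : ∀ v → count (λ u → down? u v) (allFin n) ≡ count (up? v) (allFin n)
      down≡up v = cong length (filter-≐ (λ u → down? u v) (up? v)
        ((λ (v<u , u~v) → v<u , symm u~v) , (λ (v<u , v~u) → v<u , symm v~u)) (allFin n))
      ups≡size : sum (map (λ u → count (up? u) (allFin n)) (allFin n)) ≡ size G
      ups≡size = sym (count-cartesianProduct (isEdge? G) (allFin n) (allFin n))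

    δ^2m≡product : ∀ δ → δ ^ (2 * size G) ≡ product (map (λ u → δ ^ degree G u) (allFin n))
    δ^2m≡product δ = trans (cong (δ ^_) (sym handshake)) (^-sum δ (degree G) (allFin n))

    d^d-pos : ∀ d → 0 < d ^ d
    -- Isolated vertices contribute the factor `0 ^ 0 = 1`.
    d^d-pos zero    = z<s
    d^d-pos (suc d) = m^n>0 (suc d) (suc d)

    NK*-pos : 0 < NK* G
    NK*-pos = product-pos (λ u → d^d-pos (degree G u)) (allFin n)

    module _ {δ : ℕ} (δ≤degree : ∀ u → δ ≤ degree G u) where
      δ^2m≤NK* : δ ^ (2 * size G) ≤ NK* G
      δ^2m≤NK* = subst (_≤ NK* G) (sym (δ^2m≡product δ))
        (product-mono-≤ (λ u → ^-monoˡ-≤ (degree G u) (δ≤degree u)) (allFin n))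

      δ^2m<NK* : ∀ {u} → δ < degree G u → δ ^ (2 * size G) < NK* G
      δ^2m<NK* {u} δ<d = subst (_< NK* G) (sym (δ^2m≡product δ))
        (product-mono-< (λ u → ^-monoˡ-≤ (degree G u) (δ≤degree u)) (λ u → d^d-pos (degree G u)) (∈-allFin u)
          (^-monoˡ-< (degree G u) {{>-nonZero (≤-<-trans z≤n δ<d)}} δ<d))

      NK*≤δ^2m⇒regular : NK* G ≤ δ ^ (2 * size G) → Regular G
      NK*≤δ^2m⇒regular NK*≤ u v = trans (degree≡δ u) (sym (degree≡δ v))
        where
        degree≡δ : ∀ u → degree G u ≡ δ
        degree≡δ u = ≤-antisym (≮⇒≥ λ δ<d → <⇒≱ (δ^2m<NK* δ<d) NK*≤) (δ≤degree u)

    NK*≡δ^2m : ∀ {δ} → (∀ u → degree G u ≡ δ) → NK* G ≡ δ ^ (2 * size G)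
    NK*≡δ^2m {δ} d≡δ = trans
      (cong product (map-cong (λ u → cong (_^ degree G u) (d≡δ u)) (allFin n))) (sym (δ^2m≡product δ))

open Degrees

-- Rational and real inequalities

2ℚ : ℚ
2ℚ = + 2 ℚ./ 1

toℚᵘ-/ : ∀ a b → ℚ.toℚᵘ (+ a ℚ./ suc b) ℚᵘ.≃ mkℚᵘ (+ a) b
toℚᵘ-/ a b = ℚ.toℚᵘ-fromℚᵘ (mkℚᵘ (+ a) b)

/-sum : ∀ a b k → + (a ℕ.+ b) ℚ./ suc k ≡ + a ℚ./ suc k ℚ.+ + b ℚ./ suc k
/-sum a b k = ℚ.toℚᵘ-injective (begin
  ℚ.toℚᵘ (+ (a ℕ.+ b) ℚ./ K)                   ≈⟨ toℚᵘ-/ (a ℕ.+ b) k ⟩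
  mkℚᵘ (+ (a ℕ.+ b)) k                         ≈⟨ ℚᵘ.*≡* (solve 3 (λ a b k → (a :+ b) :* (k :* k) := (a :* k :+ b :* k) :* k) refl (+ a) (+ b) (+ K)) ⟩
  mkℚᵘ (+ a) k ℚᵘ.+ mkℚᵘ (+ b) k               ≈⟨ ℚᵘ.+-cong (toℚᵘ-/ a k) (toℚᵘ-/ b k) ⟨
  ℚ.toℚᵘ (+ a ℚ./ K) ℚᵘ.+ ℚ.toℚᵘ (+ b ℚ./ K)   ≈⟨ ℚ.toℚᵘ-homo-+ (+ a ℚ./ K) (+ b ℚ./ K) ⟨
  ℚ.toℚᵘ (+ a ℚ./ K ℚ.+ + b ℚ./ K)             ∎)
  where
  open ℚᵘ.≃-Reasoning
  open ℤ-Solver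
  K = suc k

toℚᵘ-/*/ : ∀ a b c d → ℚ.toℚᵘ (+ a ℚ./ suc b ℚ.* (+ c ℚ./ suc d)) ℚᵘ.≃ mkℚᵘ (+ a) b ℚᵘ.* mkℚᵘ (+ c) d
toℚᵘ-/*/ a b c d = ℚᵘ.≃-trans (ℚ.toℚᵘ-homo-* (+ a ℚ./ suc b) (+ c ℚ./ suc d)) (ℚᵘ.*-cong (toℚᵘ-/ a b) (toℚᵘ-/ c d))

/*/-≤ : ∀ a b c d x y → a ℕ.* c ℕ.* suc y ℕ.≤ x ℕ.* (suc b ℕ.* suc d) →
  + a ℚ./ suc b ℚ.* (+ c ℚ./ suc d) ℚ.≤ + x ℚ./ suc y
/*/-≤ a b c d x y le = ℚ.toℚᵘ-cancel-≤ (ℚᵘ.≤-respˡ-≃ (ℚᵘ.≃-sym (toℚᵘ-/*/ a b c d))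
    (ℚᵘ.≤-respʳ-≃ (ℚᵘ.≃-sym (toℚᵘ-/ x y))
  (ℚᵘ.*≤* (subst₂ ℤ._≤_
    (trans (ℤ.pos-* (a ℕ.* c) (suc y)) (cong (ℤ._* + suc y) (ℤ.pos-* a c)))
    (ℤ.pos-* x (suc b ℕ.* suc d)) (ℤ.+≤+ le)))))

1≤/*/ : ∀ a b c d → suc b ℕ.* suc d ℕ.≤ a ℕ.* c → 1ℚ ℚ.≤ + a ℚ./ suc b ℚ.* (+ c ℚ./ suc d)
1≤/*/ a b c d le = ℚ.toℚᵘ-cancel-≤ (ℚᵘ.≤-respʳ-≃ (ℚᵘ.≃-sym (toℚᵘ-/*/ a b c d))
  (ℚᵘ.*≤* (subst₂ ℤ._≤_
    (sym (ℤ.*-identityˡ (+ (suc b ℕ.* suc d))))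
    (trans (ℤ.pos-* a c) (sym (ℤ.*-identityʳ (+ a ℤ.* + c)))) (ℤ.+≤+ le))))

/-anti-≤ : ∀ {k l} → k ℕ.≤ l → + 1 ℚ./ suc l ℚ.≤ + 1 ℚ./ suc k
/-anti-≤ {k} {l} k≤l = ℚ.toℚᵘ-cancel-≤ (ℚᵘ.≤-respˡ-≃ (ℚᵘ.≃-sym (toℚᵘ-/ 1 l)) (ℚᵘ.≤-respʳ-≃ (ℚᵘ.≃-sym (toℚᵘ-/ 1 k))
  (ℚᵘ.*≤* (ℤ.*-monoˡ-≤-nonNeg (+ 1) (ℤ.+≤+ (s≤s k≤l))))))

0≤p*p : ∀ p → 0ℚ ℚ.≤ p ℚ.* p
0≤p*p p = subst (0ℚ ℚ.≤_) (sq p) (*-mono ℚ.≤-refl (ℚ.0≤∣p∣ p) (ℚ.0≤∣p∣ p) (ℚ.0≤∣p∣ p))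
  where
  sq : ∀ p → ∣ p ∣ ℚ.* ∣ p ∣ ≡ p ℚ.* p
  sq p with ℚ.∣p∣≡p∨∣p∣≡-p p
  ... | inj₁ eq = cong₂ ℚ._*_ eq eq
  ... | inj₂ eq = trans (cong₂ ℚ._*_ eq eq) (solve 1 (λ p → (:- p) :* (:- p) := p :* p) refl p)
    where open ℚ-Solver

-- The difference of the two sides is `(x - y)^2 / (x y)`.
2≤x/y+y/x : ∀ {x y} → 0ℚ ℚ.< x → 0ℚ ℚ.< y → 2ℚ ℚ.≤ x ℚ.* inv y ℚ.+ y ℚ.* inv x
2≤x/y+y/x {x} {y} x>0 y>0 = subst₂ ℚ._≤_ (ℚ.+-identityʳ 2ℚ) eq
  (ℚ.+-monoʳ-≤ 2ℚ (*-mono ℚ.≤-refl (ℚ.<⇒≤ 0<uv) (0≤p*p (x ℚ.- y)) (ℚ.<⇒≤ 0<uv)))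
  where
  open ℚ-Solver
  u = inv x
  v = inv y
  0<uv : 0ℚ ℚ.< u ℚ.* v
  0<uv = *-pos (inv-pos x>0) (inv-pos y>0)
  eq : 2ℚ ℚ.+ (x ℚ.- y) ℚ.* (x ℚ.- y) ℚ.* (u ℚ.* v) ≡ x ℚ.* v ℚ.+ y ℚ.* u
  -- To the solver `u` and `v` are free variables, so the products `x u` and `y v` are first
  -- isolated as factors and then rewritten to 1.
  eq = trans
    (solve 4 (λ x y u v → con 2ℚ :+ (x :- y) :* (x :- y) :* (u :* v) :=
       con 2ℚ :+ (x :* v :* (x :* u) :- con 2ℚ :* (x :* u) :* (y :* v) :+ y :* u :* (y :* v))) refl x y u v)
    (trans (cong₂ (λ a b → 2ℚ ℚ.+ (x ℚ.* v ℚ.* a ℚ.- 2ℚ ℚ.* a ℚ.* b ℚ.+ y ℚ.* u ℚ.* b))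
        (inv-inverse x>0) (inv-inverse y>0))
    (solve 2 (λ p q → con 2ℚ :+ (p :* con 1ℚ :- con 2ℚ :* con 1ℚ :* con 1ℚ :+ q :* con 1ℚ) := p :+ q)
        refl (x ℚ.* v) (y ℚ.* u)))

-- Order on Cauchy reals

≤-eventually : ∀ {x y} → (∃ λ N → ∀ i → N ℕ.≤ i → seq x i ℚ.≤ seq y i) → x ≤ᵣ y
≤-eventually {x} {y} (N , h) = *≤* λ ε ε>0 → N , λ i N≤i →
  subst (ℚ._≤ seq y i ℚ.+ ε) (ℚ.+-identityʳ (seq x i)) (ℚ.+-mono-≤ (h i N≤i) (ℚ.<⇒≤ ε>0))

≤ᵣ-trans : ∀ {x y z} → x ≤ᵣ y → y ≤ᵣ z → x ≤ᵣ z
≤ᵣ-trans {x} {y} {z} (*≤* h) (*≤* k) = *≤* λ ε ε>0 →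
  let N , hN = h (½ ℚ.* ε) (½-pos ε>0)
      M , kM = k (½ ℚ.* ε) (½-pos ε>0)
  in N ℕ.⊔ M , λ i ≤i → begin
    seq x i                                   ≤⟨ hN i (ℕ.≤-trans (ℕ.m≤m⊔n N M) ≤i) ⟩
    seq y i ℚ.+ ½ ℚ.* ε                       ≤⟨ ℚ.+-monoˡ-≤ (½ ℚ.* ε) (kM i (ℕ.≤-trans (ℕ.m≤n⊔m N M) ≤i)) ⟩
    seq z i ℚ.+ ½ ℚ.* ε ℚ.+ ½ ℚ.* ε           ≡⟨ ℚ.+-assoc (seq z i) _ _ ⟩
    seq z i ℚ.+ (½ ℚ.* ε ℚ.+ ½ ℚ.* ε)         ≡⟨ cong (seq z i ℚ.+_) (½+½ ε) ⟩
    seq z i ℚ.+ ε                             ∎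
  where open ℚ.≤-Reasoning

≤ᵣ-antisym : ∀ {x y} → x ≤ᵣ y → y ≤ᵣ x → x ≃ᵣ y
≤ᵣ-antisym {x} {y} (*≤* h) (*≤* k) = *≃* λ ε ε>0 →
  let N , hN = h ε ε>0
      M , kM = k ε ε>0
  in N ℕ.⊔ M , λ i ≤i → abs-≤
    (p≤q+ε⇒p-q≤ε (hN i (ℕ.≤-trans (ℕ.m≤m⊔n N M) ≤i)))
    (subst (ℚ._≤ ε) (solve 2 (λ p q → q :- p := :- (p :- q)) refl (seq x i) (seq y i))
      (p≤q+ε⇒p-q≤ε (kM i (ℕ.≤-trans (ℕ.m≤n⊔m N M) ≤i))))
  where open ℚ-Solver

≃ᵣ⇒≤ᵣ : ∀ {x y} → x ≃ᵣ y → x ≤ᵣ y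
≃ᵣ⇒≤ᵣ {x} {y} (*≃* h) = *≤* λ ε ε>0 → let N , hN = h ε ε>0 in
  N , λ i N≤i → p-q≤ε⇒p≤q+ε (ℚ.≤-trans (p≤∣p∣ (seq x i ℚ.- seq y i)) (hN i N≤i))

≤ᵣ⇒≮ᵣ : ∀ {x y} → x ≤ᵣ y → y <ᵣ x → ⊥
≤ᵣ⇒≮ᵣ {x} {y} (*≤* h) (*<* (ε , ε>0 , M , k)) =
  let N , hN = h (½ ℚ.* ε) (½-pos ε>0)
      i = N ℕ.⊔ M
  in ℚ.<-irrefl refl (begin-strict
    seq y i ℚ.+ ½ ℚ.* ε                          <⟨ ℚ.+-monoʳ-< (seq y i) (subst (ℚ._< ½ ℚ.* ε ℚ.+ ½ ℚ.* ε) (ℚ.+-identityʳ (½ ℚ.* ε)) (ℚ.+-monoʳ-< (½ ℚ.* ε) (½-pos ε>0))) ⟩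
    seq y i ℚ.+ (½ ℚ.* ε ℚ.+ ½ ℚ.* ε)            ≡⟨ cong (seq y i ℚ.+_) (½+½ ε) ⟩
    seq y i ℚ.+ ε                                ≤⟨ k i (ℕ.m≤n⊔m N M) ⟩
    seq x i                                      ≤⟨ hN i (ℕ.m≤m⊔n N M) ⟩
    seq y i ℚ.+ ½ ℚ.* ε                          ∎)
  where open ℚ.≤-Reasoning

+ᵣ-mono-≤ : ∀ {x y z w} → x ≤ᵣ y → z ≤ᵣ w → x +ᵣ z ≤ᵣ y +ᵣ w
+ᵣ-mono-≤ {x} {y} {z} {w} (*≤* h) (*≤* k) = *≤* λ ε ε>0 →
  let N , hN = h (½ ℚ.* ε) (½-pos ε>0)
      M , kM = k (½ ℚ.* ε) (½-pos ε>0)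
  in N ℕ.⊔ M , λ i ≤i → begin
    seq x i ℚ.+ seq z i
      ≤⟨ ℚ.+-mono-≤ (hN i (ℕ.≤-trans (ℕ.m≤m⊔n N M) ≤i)) (kM i (ℕ.≤-trans (ℕ.m≤n⊔m N M) ≤i)) ⟩
    (seq y i ℚ.+ ½ ℚ.* ε) ℚ.+ (seq w i ℚ.+ ½ ℚ.* ε)
      ≡⟨ solve 3 (λ y w e → (y :+ e) :+ (w :+ e) := (y :+ w) :+ (e :+ e)) refl (seq y i) (seq w i) (½ ℚ.* ε) ⟩
    (seq y i ℚ.+ seq w i) ℚ.+ (½ ℚ.* ε ℚ.+ ½ ℚ.* ε)
      ≡⟨ cong ((seq y i ℚ.+ seq w i) ℚ.+_) (½+½ ε) ⟩
    (seq y i ℚ.+ seq w i) ℚ.+ ε ∎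
  where
  open ℚ.≤-Reasoning
  open ℚ-Solver

seq-pos : ∀ {x} → 0ᵣ <ᵣ x → ∃ λ η → 0ℚ ℚ.< η × ∃ λ N → ∀ i → N ℕ.≤ i → η ℚ.≤ seq x i
seq-pos {x} (*<* (η , η>0 , N , h)) = η , η>0 , N , λ i N≤i → subst (ℚ._≤ seq x i) (ℚ.+-identityˡ η) (h i N≤i)

module _ {x y : ℝ} (0<x : 0ᵣ <ᵣ x) (0<y : 0ᵣ <ᵣ y) where
  2≤ratio+ratio : fromℚ 2ℚ ≤ᵣ (x /ᵣ y [ 0<y ]) +ᵣ (y /ᵣ x [ 0<x ])
  2≤ratio+ratio =
    let η , η>0 , N , hN = seq-pos 0<x
        θ , θ>0 , M , hM = seq-pos 0<y
    in ≤-eventually (N ℕ.⊔ M , λ i ≤i →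
         2≤x/y+y/x (ℚ.<-≤-trans η>0 (hN i (ℕ.≤-trans (ℕ.m≤m⊔n N M) ≤i)))
                   (ℚ.<-≤-trans θ>0 (hM i (ℕ.≤-trans (ℕ.m≤n⊔m N M) ≤i))))

  -- Equal degrees give the same sequence of approximations, so termwise equality is at hand and
  -- both ratios are eventually exactly 1.
  ratio+ratio≤2 : (∀ i → seq x i ≡ seq y i) → (x /ᵣ y [ 0<y ]) +ᵣ (y /ᵣ x [ 0<x ]) ≤ᵣ fromℚ 2ℚ
  ratio+ratio≤2 x≡y =
    let η , η>0 , N , hN = seq-pos 0<x
    in ≤-eventually (N , λ i N≤i →
         let 1≡ = inv-inverse (ℚ.<-≤-trans η>0 (hN i N≤i)) in
         ℚ.≤-reflexive (cong₂ ℚ._+_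
           (trans (cong (λ z → seq x i ℚ.* inv z) (sym (x≡y i))) 1≡)
           (trans (cong (λ z → z ℚ.* inv (seq x i)) (sym (x≡y i))) 1≡)))

suc-/1 : ∀ k c → + suc k ℚ./ 1 ℚ.* c ≡ c ℚ.+ + k ℚ./ 1 ℚ.* c
suc-/1 k c = begin
  + suc k ℚ./ 1 ℚ.* c                     ≡⟨ cong (ℚ._* c) (/-sum 1 k 0) ⟩
  (+ 1 ℚ./ 1 ℚ.+ + k ℚ./ 1) ℚ.* c         ≡⟨ ℚ.*-distribʳ-+ c (+ 1 ℚ./ 1) (+ k ℚ./ 1) ⟩
  + 1 ℚ./ 1 ℚ.* c ℚ.+ + k ℚ./ 1 ℚ.* c     ≡⟨ cong (ℚ._+ + k ℚ./ 1 ℚ.* c) (ℚ.*-identityˡ c) ⟩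
  c ℚ.+ + k ℚ./ 1 ℚ.* c                   ∎
  where open ≡-Reasoning

-- Sums with a constant bound on each term

-- The recursion mirrors `foldr _+ᵣ_ 0ᵣ`, so that the inductions over sums unfold it by computation;
-- `multiple≡` supplies the closed form.
multiple : ℕ → ℚ → ℚ
multiple zero    c = 0ℚ
multiple (suc k) c = c ℚ.+ multiple k c

multiple≡ : ∀ k c → multiple k c ≡ + k ℚ./ 1 ℚ.* c
multiple≡ zero    c = sym (ℚ.*-zeroˡ c)
multiple≡ (suc k) c = trans (cong (c ℚ.+_) (multiple≡ k c)) (sym (suc-/1 k c))

module _ {A : Set} {P : A → Set} (f : ∀ {x} → P x → ℝ) (c : ℚ) where
  private
    total : ∀ {xs} → All P xs → ℝ
    total ps = foldr _+ᵣ_ 0ᵣ (reduce f ps)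

    bound : List A → ℝ
    bound xs = fromℚ (multiple (length xs) c)

  -- Sums are re-bracketed through their sequences, and ≤ᵣ proofs rewrapped by *≤* below, since comparing
  -- the reals themselves makes Agda unfold and compare their Cauchy moduli.
  private
    unfold-≤ : ∀ {x xs} (p : P x) (ps : All P xs) → f p +ᵣ total ps ≤ᵣ total (p ∷ ps)
    unfold-≤ p ps = ≤-eventually (0 , λ _ _ → ℚ.≤-refl)

    unfold-≥ : ∀ {x xs} (p : P x) (ps : All P xs) → total (p ∷ ps) ≤ᵣ f p +ᵣ total ps
    unfold-≥ p ps = ≤-eventually (0 , λ _ _ → ℚ.≤-refl)

  sum-reduce-≥ : (∀ {x} (p : P x) → fromℚ c ≤ᵣ f p) → ∀ {xs} (ps : All P xs) → bound xs ≤ᵣ total ps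
  sum-reduce-≥ c≤f []       = ≤-eventually (0 , λ _ _ → ℚ.≤-refl)
  sum-reduce-≥ c≤f {x ∷ xs} (p ∷ ps) = ≤ᵣ-trans {bound (x ∷ xs)} {fromℚ c +ᵣ bound xs} {total (p ∷ ps)}
    (≤-eventually (0 , λ _ _ → ℚ.≤-refl))
    (≤ᵣ-trans {fromℚ c +ᵣ bound xs} {f p +ᵣ total ps} {total (p ∷ ps)}
      (+ᵣ-mono-≤ {fromℚ c} {f p} {bound xs} {total ps} (c≤f p) (sum-reduce-≥ c≤f ps))
      (unfold-≤ p ps))

  sum-reduce-≤ : (∀ {x} (p : P x) → f p ≤ᵣ fromℚ c) → ∀ {xs} (ps : All P xs) → total ps ≤ᵣ bound xs
  sum-reduce-≤ f≤c []       = ≤-eventually (0 , λ _ _ → ℚ.≤-refl)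
  sum-reduce-≤ f≤c {x ∷ xs} (p ∷ ps) = ≤ᵣ-trans {total (p ∷ ps)} {f p +ᵣ total ps} {bound (x ∷ xs)}
    (unfold-≥ p ps)
    (≤ᵣ-trans {f p +ᵣ total ps} {fromℚ c +ᵣ bound xs} {bound (x ∷ xs)}
      (+ᵣ-mono-≤ {f p} {fromℚ c} {total ps} {bound xs} (f≤c p) (sum-reduce-≤ f≤c ps))
      (≤-eventually (0 , λ _ _ → ℚ.≤-refl)))

-- Products of approximated powers with opposite exponents

-- p = j σ and s = -σ with σ > 0, spelled out for the numerators and denominators; the last field
-- bounds σ from below by 1 / ↧ₙ θ.
record OppositeExponents (j : ℕ) (p s : ℚ) : Set where
  field
    p⁻≡0 : (↥ p) ⁻ ≡ 0
    s⁺≡0 : (↥ s) ⁺ ≡ 0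
    cross : (↥ p) ⁺ ℕ.* ↧ₙ s ≡ j ℕ.* ((↥ s) ⁻ ℕ.* ↧ₙ p)
    ↧≤ : ∀ θ → 0ℚ ℚ.< θ → θ ℚ.≤ ℚ.- s → ↧ₙ s ℕ.≤ ↧ₙ θ ℕ.* (↥ s) ⁻

oppositeExponents : ∀ j p s → 0ℚ ℚ.< p → 0ℚ ℚ.< ℚ.- s → p ≡ + j ℚ./ 1 ℚ.* (ℚ.- s) → OppositeExponents j p s
oppositeExponents j (mkℚ -[1+ _ ] _ _) _ (ℚ.*<* ()) _ _
oppositeExponents j p@(mkℚ (+ _) _ _) (mkℚ (+ zero) _ _) _ (ℚ.*<* (ℤ.+<+ ())) _
oppositeExponents j p@(mkℚ (+ _) _ _) (mkℚ (+ suc _) _ _) _ (ℚ.*<* ()) _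
oppositeExponents j p@(mkℚ (+ a) k _) s@(mkℚ -[1+ c ] l _) _ _ eq = record
  { p⁻≡0 = refl ; s⁺≡0 = refl ; cross = cross ; ↧≤ = ↧≤ }
  where
  -- Unnormalised fractions keep numerators and denominators free of gcd cancellation, so that
  -- `cross` is plain cross-multiplication.
  eqᵘ : mkℚᵘ (+ a) k ℚᵘ.≃ mkℚᵘ (+ j) 0 ℚᵘ.* mkℚᵘ (+ suc c) l
  eqᵘ = ℚᵘ.≃-trans (ℚᵘ.≃-reflexive (cong ℚ.toℚᵘ eq))
    (ℚᵘ.≃-trans (ℚ.toℚᵘ-homo-* (+ j ℚ./ 1) (ℚ.- s)) (ℚᵘ.*-congʳ (toℚᵘ-/ j 0)))
  cross : a ℕ.* suc l ≡ j ℕ.* (suc c ℕ.* suc k)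
  cross = ℤ.+-injective (trans (ℤ.pos-* a (suc l))
    (trans (trans (cong (λ z → + a ℤ.* + z) (sym (ℕ.*-identityˡ (suc l)))) (ℚᵘ.drop-*≡* eqᵘ))
    (trans (ℤ.*-assoc (+ j) (+ suc c) (+ suc k))
      (sym (trans (ℤ.pos-* j _) (cong (+ j ℤ.*_) (ℤ.pos-* (suc c) (suc k))))))))
  ↧≤ : ∀ θ → 0ℚ ℚ.< θ → θ ℚ.≤ ℚ.- s → suc l ℕ.≤ ↧ₙ θ ℕ.* suc c
  ↧≤ θ θ>0 θ≤ = ℤ.drop‿+≤+ (subst₂ ℤ._≤_ (ℤ.*-identityˡ (+ suc l))
    (trans (ℤ.*-comm (+ suc c) (+ ↧ₙ θ)) (sym (ℤ.pos-* (↧ₙ θ) (suc c))))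
    (ℚᵘ.drop-*≤* (ℚᵘ.≤-trans (ℚᵘ.≤-reflexive (ℚᵘ.≃-sym (toℚᵘ-/ 1 (ℚ.ℚ.denominator-1 θ))))
      (ℚ.toℚᵘ-mono-≤ (ℚ.≤-trans (1/↧≤ θ>0) θ≤)))))

module _ {j : ℕ} {p s : ℚ} (opp : OppositeExponents j p s) {d n : ℕ} .{{_ : ℕ.NonZero n}} (i : ℕ) where
  open OppositeExponents opp

  private
    M = suc i
    t = root d p M
    t′ = root n s M

  -- The bound is independent of `i`. The gap hypothesis and `x ≤ suc y` force `d^j ≤ n`, so the
  -- exponent `-s` may be lowered to the fixed `1 / ↧ₙ θ`, where the gap hypothesis itself gives the
  -- estimate.
  approx-product-≤ : ∀ {x y} θ → 0ℚ ℚ.< θ → θ ℚ.≤ ℚ.- s →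
    d ℕ.^ j ℕ.* suc y ℕ.^ ↧ₙ θ ℕ.≤ n ℕ.* x ℕ.^ ↧ₙ θ → x ℕ.≤ suc y →
    approx d p i ℚ.* approx n s i ℚ.≤ + x ℚ./ suc y
  approx-product-≤ {x} {y} θ θ>0 θ≤ gap x≤y = /*/-≤ t i t′ i x y
    (root-product-upper {t} {t′} {d} {n} {(↥ p) ⁺} {(↥ s) ⁻} {j} {x} {suc y} {↧ₙ θ} {M} {M} (↧ₙ p) (↧ₙ s)
      (subst (ℕ._≤ d ℕ.^ (↥ p) ⁺ ℕ.* M ℕ.^ ↧ₙ p)
          (trans (cong (λ z → t ℕ.^ ↧ₙ p ℕ.* d ℕ.^ z) p⁻≡0) (ℕ.*-identityʳ _)) (root-sound d p M))
      (subst (t′ ℕ.^ ↧ₙ s ℕ.* n ℕ.^ (↥ s) ⁻ ℕ.≤_)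
          (trans (cong (λ z → n ℕ.^ z ℕ.* M ℕ.^ ↧ₙ s) s⁺≡0) (ℕ.*-identityˡ _)) (root-sound n s M))
      cross gap x≤y (↧≤ θ θ>0 θ≤))

  -- The approximations round down; one unit `1/M` more puts each of them above the exact power, and
  -- the exact powers multiply to 1.
  approx-product-≥ : .{{_ : ℕ.NonZero d}} → n ≡ d ℕ.^ j →
    1ℚ ℚ.≤ (+ 1 ℚ./ M ℚ.+ approx d p i) ℚ.* (+ 1 ℚ./ M ℚ.+ approx n s i)
  approx-product-≥ n≡ = subst (1ℚ ℚ.≤_) (cong₂ ℚ._*_ (/-sum 1 t i) (/-sum 1 t′ i)) (1≤/*/ (suc t) i (suc t′) i
    (root-product-lower {suc t} {suc t′} {d} {n} {(↥ p) ⁺} {(↥ s) ⁻} {j} {M} {M} (↧ₙ p) (↧ₙ s)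
      (subst (d ℕ.^ (↥ p) ⁺ ℕ.* M ℕ.^ ↧ₙ p ℕ.≤_)
          (trans (cong (λ z → suc t ℕ.^ ↧ₙ p ℕ.* d ℕ.^ z) p⁻≡0) (ℕ.*-identityʳ _)) (root-maximal d p M))
      (subst (ℕ._≤ suc t′ ℕ.^ ↧ₙ s ℕ.* n ℕ.^ (↥ s) ⁻)
          (trans (cong (λ z → n ℕ.^ z ℕ.* M ℕ.^ ↧ₙ s) s⁺≡0) (ℕ.*-identityˡ _)) (root-maximal n s M))
      cross n≡))

-- With `u = 1/(i+1)` the product is `a b + u (u + a + b)`, and the cofactor of `u` stays bounded
-- because Cauchy sequences do.
1≤limit : ∀ x y → (∃ λ N → ∀ i → N ℕ.≤ i → 1ℚ ℚ.≤ (+ 1 ℚ./ suc i ℚ.+ seq x i) ℚ.* (+ 1 ℚ./ suc i ℚ.+ seq y i)) →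
  fromℚ 1ℚ ≤ᵣ x *ᵣ y
1≤limit x y (N , h) = *≤* λ ε ε>0 →
  let B , B>0 , N₁ , hB = bounded x
      C , C>0 , N₂ , hC = bounded y
      -- `S` bounds `u + (a + b)`, so `u ≤ κ = ε / S` is enough; this holds once `i` reaches the
      -- denominator of `κ`.
      S = 1ℚ ℚ.+ (B ℚ.+ C)
      S>0 = ℚ.+-mono-< (ℚ.positive⁻¹ 1ℚ) (ℚ.+-mono-< B>0 C>0)
      κ = ε ℚ.* inv S
      κ>0 = *-pos ε>0 (inv-pos S>0)
      E = ↧ₙ κ
  in N ℕ.⊔ (N₁ ℕ.⊔ (N₂ ℕ.⊔ E)) , λ i ≤i →
  let ≤₁ = ℕ.≤-trans (ℕ.m≤n⊔m N _) ≤i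
      ≤₂ = ℕ.≤-trans (ℕ.m≤n⊔m N₁ _) ≤₁
      u = + 1 ℚ./ suc i
      a = seq x i
      b = seq y i
      u>0 = 1/-pos i
      u≤κ = ℚ.≤-trans (/-anti-≤ (ℕ.≤-trans (ℕ.≤-trans (ℕ.n≤1+n (ℚ.ℚ.denominator-1 κ)) (ℕ.m≤n⊔m N₂ E)) ≤₂)) (1/↧≤ κ>0)
      u≤1 = /-anti-≤ {0} {i} z≤n
      a≤B = ℚ.≤-trans (p≤∣p∣ a) (hB i (ℕ.≤-trans (ℕ.m≤m⊔n N₁ _) ≤₁))
      b≤C = ℚ.≤-trans (p≤∣p∣ b) (hC i (ℕ.≤-trans (ℕ.m≤m⊔n N₂ _) ≤₂))
  in begin
    1ℚ                               ≤⟨ h i (ℕ.≤-trans (ℕ.m≤m⊔n N _) ≤i) ⟩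
    (u ℚ.+ a) ℚ.* (u ℚ.+ b)          ≡⟨ solve 3 (λ u a b → (u :+ a) :* (u :+ b) := a :* b :+ u :* (u :+ (a :+ b))) refl u a b ⟩
    a ℚ.* b ℚ.+ u ℚ.* (u ℚ.+ (a ℚ.+ b))
      ≤⟨ ℚ.+-monoʳ-≤ (a ℚ.* b) (*-mono (ℚ.<⇒≤ u>0) (ℚ.<⇒≤ S>0) u≤κ (ℚ.+-mono-≤ u≤1 (ℚ.+-mono-≤ a≤B b≤C))) ⟩
    a ℚ.* b ℚ.+ ε ℚ.* inv S ℚ.* S
      ≡⟨ cong (a ℚ.* b ℚ.+_) (trans (solve 3 (λ e v s → e :* v :* s := e :* (s :* v)) refl ε (inv S) S)
           (trans (cong (ε ℚ.*_) (inv-inverse S>0)) (ℚ.*-identityʳ ε))) ⟩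
    a ℚ.* b ℚ.+ ε ∎
  where
  open ℚ.≤-Reasoning
  open ℚ-Solver

/-unit : ∀ k → + suc k ℚ./ suc k ≡ 1ℚ
/-unit k = ℚ.toℚᵘ-injective (ℚᵘ.≃-trans (toℚᵘ-/ (suc k) k) (ℚᵘ.*≡* (ℤ.*-comm (+ suc k) (+ 1))))

/1-pos : ∀ {k} → 0 ℕ.< k → 0ℚ ℚ.< + k ℚ./ 1
/1-pos {suc k} _ = ℚ.positive⁻¹ (+ suc k ℚ./ 1) {{ℚ.normalize-pos (suc k) 1}}

/1-double : ∀ k → + (2 ℕ.* k) ℚ./ 1 ≡ 2ℚ ℚ.* (+ k ℚ./ 1)
/1-double k = begin
  + (2 ℕ.* k) ℚ./ 1                 ≡⟨ cong (λ z → + (k ℕ.+ z) ℚ./ 1) (ℕ.+-identityʳ k) ⟩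
  + (k ℕ.+ k) ℚ./ 1                 ≡⟨ /-sum k k 0 ⟩
  + k ℚ./ 1 ℚ.+ + k ℚ./ 1           ≡⟨ solve 1 (λ p → p :+ p := con 2ℚ :* p) refl (+ k ℚ./ 1) ⟩
  2ℚ ℚ.* (+ k ℚ./ 1)                ∎
  where
  open ≡-Reasoning
  open ℚ-Solver

-- The fraction `x / (x+1)` misses 1 by exactly `1 / (x+1)`; scaled by `c`, this is the uniform gap
-- that `<ᵣ` asks for.
scaled-gap : ∀ {c z} x → 0ℚ ℚ.≤ c → z ℚ.≤ + x ℚ./ suc x → c ℚ.* z ℚ.+ c ℚ.* (+ 1 ℚ./ suc x) ℚ.≤ c
scaled-gap {c} {z} x c≥0 z≤ρ = begin
  c ℚ.* z ℚ.+ c ℚ.* u  ≤⟨ ℚ.+-monoˡ-≤ (c ℚ.* u) (ℚ.*-monoˡ-≤-nonNeg c {{ℚ.nonNegative c≥0}} z≤ρ) ⟩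
  c ℚ.* ρ ℚ.+ c ℚ.* u  ≡⟨ ℚ.*-distribˡ-+ c ρ u ⟨
  c ℚ.* (ρ ℚ.+ u)      ≡⟨ cong (c ℚ.*_) (trans (ℚ.+-comm ρ u) (trans (sym (/-sum 1 x x)) (/-unit x))) ⟩
  c ℚ.* 1ℚ             ≡⟨ ℚ.*-identityʳ c ⟩
  c                    ∎
  where
  open ℚ.≤-Reasoning
  u = + 1 ℚ./ suc x
  ρ = + x ℚ./ suc x

scaled-≥ : ∀ {c z ε} → 0ℚ ℚ.< c → 1ℚ ℚ.≤ z ℚ.+ inv c ℚ.* ε → c ℚ.≤ c ℚ.* z ℚ.+ ε
scaled-≥ {c} {z} {ε} c>0 1≤ = begin
  c                                ≡⟨ ℚ.*-identityʳ c ⟨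
  c ℚ.* 1ℚ                         ≤⟨ ℚ.*-monoˡ-≤-nonNeg c {{ℚ.nonNegative (ℚ.<⇒≤ c>0)}} 1≤ ⟩
  c ℚ.* (z ℚ.+ inv c ℚ.* ε)        ≡⟨ ℚ.*-distribˡ-+ c z (inv c ℚ.* ε) ⟩
  c ℚ.* z ℚ.+ c ℚ.* (inv c ℚ.* ε)  ≡⟨ cong (c ℚ.* z ℚ.+_) (ℚ.*-assoc c (inv c) ε) ⟨
  c ℚ.* z ℚ.+ c ℚ.* inv c ℚ.* ε    ≡⟨ cong (λ y → c ℚ.* z ℚ.+ y ℚ.* ε) (inv-inverse c>0) ⟩
  c ℚ.* z ℚ.+ 1ℚ ℚ.* ε             ≡⟨ cong (c ℚ.* z ℚ.+_) (ℚ.*-identityˡ ε) ⟩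
  c ℚ.* z ℚ.+ ε                    ∎
  where open ℚ.≤-Reasoning

-- The bound

module _ (α : ℝ) (0<α : 0ᵣ <ᵣ α) {m : ℕ} (m>0 : 0 ℕ.< m) where
  private
    p s : ℕ → ℚ
    p i = 2ℚ ℚ.* seq α i
    s i = (ℚ.- seq α i) ℚ.* inv (+ m ℚ./ 1)

  -- The relation `p i = 2m (- s i)` holds at every index; only the signs have to wait until the
  -- terms of `α` exceed some `η > 0`. Then `θ = η / m` bounds `- s i` from below.
  oppositeExponents-eventually : ∃ λ θ → 0ℚ ℚ.< θ × ∃ λ N → ∀ i → N ℕ.≤ i →
    OppositeExponents (2 ℕ.* m) (p i) (s i) × θ ℚ.≤ ℚ.- s i
  oppositeExponents-eventually =
    let η , η>0 , N , hN = seq-pos 0<α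
        μ = inv (+ m ℚ./ 1)
        μ>0 = inv-pos (/1-pos m>0)
        θ>0 = *-pos η>0 μ>0
    in η ℚ.* μ , θ>0 , N , λ i N≤i →
    let a = seq α i
        a>0 = ℚ.<-≤-trans η>0 (hN i N≤i)
        -s≡ = solve 2 (λ a μ → :- ((:- a) :* μ) := a :* μ) refl a μ
        θ≤ = subst (η ℚ.* μ ℚ.≤_) (sym -s≡) (*-mono (ℚ.<⇒≤ η>0) (ℚ.<⇒≤ μ>0) (hN i N≤i) ℚ.≤-refl)
    in oppositeExponents (2 ℕ.* m) (p i) (s i) (*-pos (ℚ.positive⁻¹ 2ℚ) a>0) (ℚ.<-≤-trans θ>0 θ≤)
         (sym (begin
           + (2 ℕ.* m) ℚ./ 1 ℚ.* (ℚ.- s i)     ≡⟨ cong₂ ℚ._*_ (/1-double m) -s≡ ⟩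
           2ℚ ℚ.* (+ m ℚ./ 1) ℚ.* (a ℚ.* μ)    ≡⟨ solve 4 (λ t k a μ → t :* k :* (a :* μ) := t :* a :* (k :* μ)) refl 2ℚ (+ m ℚ./ 1) a μ ⟩
           2ℚ ℚ.* a ℚ.* (+ m ℚ./ 1 ℚ.* μ)      ≡⟨ cong (2ℚ ℚ.* a ℚ.*_) (inv-inverse (/1-pos m>0)) ⟩
           2ℚ ℚ.* a ℚ.* 1ℚ                     ≡⟨ ℚ.*-identityʳ (2ℚ ℚ.* a) ⟩
           2ℚ ℚ.* a                            ∎))
       , θ≤
    where
    open ≡-Reasoning
    open ℚ-Solver

  module _ (d n : ℕ) (n>0 : 0 ℕ.< n) where
    minPower normPower : ℝ
    minPower  = d ^ᵣ (fromℕ 2 *ᵣ α)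
    normPower = n ^ᵣ ((-ᵣ α) /ᵣ fromℕ m [ fromℕ-pos m>0 ])

    lowerBound : ℝ
    lowerBound = fromℕ 2 *ᵣ minPower *ᵣ fromℕ m *ᵣ normPower

    -- The value `2m`, with its factors in the order in which `multiple≡` produces them for the sum
    -- over the edges.
    cap : ℚ
    cap = + m ℚ./ 1 ℚ.* 2ℚ

    cap>0 : 0ℚ ℚ.< cap
    cap>0 = *-pos (/1-pos m>0) (ℚ.positive⁻¹ 2ℚ)

    lowerBound≡ : ∀ i → seq lowerBound i ≡ cap ℚ.* (seq minPower i ℚ.* seq normPower i)
    lowerBound≡ i = solve 4 (λ t D k Q → t :* D :* k :* Q := k :* t :* (D :* Q)) refl 2ℚ (seq minPower i) (+ m ℚ./ 1) (seq normPower i)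
      where open ℚ-Solver

    power-product-≤ : let θ , _ = oppositeExponents-eventually in
      ∀ x y → d ℕ.^ (2 ℕ.* m) ℕ.* suc y ℕ.^ ↧ₙ θ ℕ.≤ n ℕ.* x ℕ.^ ↧ₙ θ → x ℕ.≤ suc y →
      ∃ λ N → ∀ i → N ℕ.≤ i → seq minPower i ℚ.* seq normPower i ℚ.≤ + x ℚ./ suc y
    power-product-≤ x y gap x≤y = go d n n>0 gap
      where
      θ = proj₁ oppositeExponents-eventually
      θ>0 = proj₁ (proj₂ oppositeExponents-eventually)
      -- The bases are generalised so that they can be split: `_^ᵣ_` computes only on `zero` or
      -- `suc`.
      go : ∀ d n → 0 ℕ.< n → d ℕ.^ (2 ℕ.* m) ℕ.* suc y ℕ.^ ↧ₙ θ ℕ.≤ n ℕ.* x ℕ.^ ↧ₙ θ →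
        ∃ λ N → ∀ i → N ℕ.≤ i →
          seq (d ^ᵣ (fromℕ 2 *ᵣ α)) i ℚ.* seq (n ^ᵣ ((-ᵣ α) /ᵣ fromℕ m [ fromℕ-pos m>0 ])) i ℚ.≤ + x ℚ./ suc y
      -- For minimum degree 0 the power is `0ᵣ`, the right value since the exponent `2α` is
      -- positive.
      go zero n@(suc _) _ _ = 0 , λ i _ → subst (ℚ._≤ + x ℚ./ suc y) (sym (ℚ.*-zeroˡ (approx n (s i) i)))
        (ℚ.nonNegative⁻¹ (+ x ℚ./ suc y) {{ℚ.normalize-nonNeg x (suc y)}})
      go d@(suc _) n@(suc _) _ gap = let θ , θ>0 , N , h = oppositeExponents-eventually in
        N , λ i N≤i → approx-product-≤ (proj₁ (h i N≤i)) {d} {n} i θ θ>0 (proj₂ (h i N≤i)) gap x≤y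

    lowerBound≤cap : d ℕ.^ (2 ℕ.* m) ℕ.≤ n → lowerBound ≤ᵣ fromℚ cap
    lowerBound≤cap d^2m≤n =
      let θ = proj₁ oppositeExponents-eventually
          -- The target ratio is `1 / 1`, for which the gap hypothesis is just `d^(2m) ≤ n`.
          N , h = power-product-≤ 1 0 (ℕ.*-mono-≤ d^2m≤n ℕ.≤-refl) ℕ.≤-refl
      in ≤-eventually (N , λ i N≤i → begin
           seq lowerBound i                                ≡⟨ lowerBound≡ i ⟩
           cap ℚ.* (seq minPower i ℚ.* seq normPower i)   
               ≤⟨ ℚ.*-monoˡ-≤-nonNeg cap {{ℚ.nonNegative (ℚ.<⇒≤ cap>0)}} (h i N≤i) ⟩
           cap ℚ.* 1ℚ                                      ≡⟨ ℚ.*-identityʳ cap ⟩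
           cap                                             ∎)
      where open ℚ.≤-Reasoning

    lowerBound<cap : d ℕ.^ (2 ℕ.* m) ℕ.< n → lowerBound <ᵣ fromℚ cap
    lowerBound<cap d^2m<n =
      let θ = proj₁ oppositeExponents-eventually
          E = ↧ₙ θ
          -- Chosen so that `x / (x+1) = 1 - 1/(nE)`, the ratio provided by `root-gap`.
          x = ℕ.pred (n ℕ.* E)
          x+1≡ = ℕ.suc-pred (n ℕ.* E) {{ℕ.m*n≢0 n E {{ℕ.>-nonZero n>0}}}}
          N , h = power-product-≤ x x (root-gap E d^2m<n x+1≡) (ℕ.n≤1+n x)
      in *<* (cap ℚ.* (+ 1 ℚ./ suc x) , *-pos cap>0 (1/-pos x) , N , λ i N≤i →
           subst (λ z → z ℚ.+ cap ℚ.* (+ 1 ℚ./ suc x) ℚ.≤ cap) (sym (lowerBound≡ i))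
             (scaled-gap x (ℚ.<⇒≤ cap>0) (h i N≤i)))

    power-product-≥ : n ≡ d ℕ.^ (2 ℕ.* m) → fromℚ 1ℚ ≤ᵣ minPower *ᵣ normPower
    power-product-≥ n≡ = 1≤limit minPower normPower (go d n n>0 n≡)
      where
      0^2m : ∀ {m} → 0 ℕ.< m → 0 ℕ.^ (2 ℕ.* m) ≡ 0
      0^2m {suc _} _ = refl
      go : ∀ d n → 0 ℕ.< n → n ≡ d ℕ.^ (2 ℕ.* m) → ∃ λ N → ∀ i → N ℕ.≤ i →
        1ℚ ℚ.≤ (+ 1 ℚ./ suc i ℚ.+ seq (d ^ᵣ (fromℕ 2 *ᵣ α)) i) ℚ.*
               (+ 1 ℚ./ suc i ℚ.+ seq (n ^ᵣ ((-ᵣ α) /ᵣ fromℕ m [ fromℕ-pos m>0 ])) i)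
      -- With `m > 0` the base `d = 0` would give `n = 0`.
      go zero n n>0 n≡ = ⊥-elim (ℕ.<-irrefl (sym (trans n≡ (0^2m m>0))) n>0)
      go d@(suc _) n@(suc _) _ n≡ = let θ , θ>0 , N , h = oppositeExponents-eventually in
        N , λ i N≤i → approx-product-≥ (proj₁ (h i N≤i)) {d} {n} i n≡

    cap≤lowerBound : n ≡ d ℕ.^ (2 ℕ.* m) → fromℚ cap ≤ᵣ lowerBound
    cap≤lowerBound n≡ = *≤* λ ε ε>0 →
      let N , h = _≤ᵣ_.≤-within (power-product-≥ n≡) (inv cap ℚ.* ε) (*-pos (inv-pos cap>0) ε>0)
      in N , λ i N≤i → subst (λ z → cap ℚ.≤ z ℚ.+ ε) (sym (lowerBound≡ i))
           (scaled-≥ {cap} {seq minPower i ℚ.* seq normPower i} cap>0 (h i N≤i))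

-- The symmetric division deg index against `2m`

module _ {n : ℕ} (G : Graph n) (α : ℝ) where
  private
    edgeProofs = all-filter (isEdge? G) (vertexPairs G)

  2≤sddTerm : ∀ {uv} (e : IsEdge G uv) → fromℚ 2ℚ ≤ᵣ sddTerm G α e
  2≤sddTerm {u , v} (_ , u~v) = *≤* (_≤ᵣ_.≤-within
    (2≤ratio+ratio {degree G u ^ᵣ α} {degree G v ^ᵣ α}
        (^ᵣ-pos α (degree-pos G u~v)) (^ᵣ-pos α (degree-pos G (Graph.symm G u~v)))))

  sddTerm≤2 : Regular G → ∀ {uv} (e : IsEdge G uv) → sddTerm G α e ≤ᵣ fromℚ 2ℚ
  sddTerm≤2 regular {u , v} (_ , u~v) = *≤* (_≤ᵣ_.≤-within
    (ratio+ratio≤2 {degree G u ^ᵣ α} {degree G v ^ᵣ α}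
        (^ᵣ-pos α (degree-pos G u~v)) (^ᵣ-pos α (degree-pos G (Graph.symm G u~v)))
      (λ i → cong (λ d → seq (d ^ᵣ α) i) (regular u v))))

  cap≤SDD : fromℚ (+ size G ℚ./ 1 ℚ.* 2ℚ) ≤ᵣ SDD G α
  cap≤SDD = subst (λ c → fromℚ c ≤ᵣ SDD G α) (multiple≡ (size G) 2ℚ)
    (*≤* (_≤ᵣ_.≤-within (sum-reduce-≥ (sddTerm G α) 2ℚ 2≤sddTerm edgeProofs)))

  SDD≤cap : Regular G → SDD G α ≤ᵣ fromℚ (+ size G ℚ./ 1 ℚ.* 2ℚ)
  SDD≤cap regular = subst (λ c → SDD G α ≤ᵣ fromℚ c) (multiple≡ (size G) 2ℚ)
    (*≤* (_≤ᵣ_.≤-within (sum-reduce-≤ (sddTerm G α) 2ℚ (sddTerm≤2 regular) edgeProofs)))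

theorem5 : ∀ {n} (G : Graph n) (δ : ℕ) (α : ℝ) →
    (m≥1 : 1 ≤ size G) → IsMinDegree G δ → 0ᵣ <ᵣ α →
    let m     = size G
        bound = fromℕ 2 *ᵣ δ ^ᵣ (fromℕ 2 *ᵣ α) *ᵣ fromℕ m *ᵣ NK* G ^ᵣ ((-ᵣ α) /ᵣ fromℕ m [ fromℕ-pos m≥1 ])
    in SDD G α ≥ᵣ bound × (SDD G α ≃ᵣ bound ⇔ Regular G)
theorem5 {n} G δ α m≥1 (δ≤degree , u₀ , degree-u₀≡δ) 0<α =
  *≤* (_≤ᵣ_.≤-within bound≤SDD) ,
  mk⇔ (λ { (*≃* h) → equality⇒regular (*≃* h) })
      (λ regular → *≃* (_≃ᵣ_.≃-within (regular⇒equality regular)))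
  where
  bound cap₂ : ℝ
  bound = lowerBound α 0<α m≥1 δ (NK* G) (NK*-pos G)
  cap₂  = fromℚ (cap α 0<α m≥1 δ (NK* G) (NK*-pos G))

  bound≤SDD : bound ≤ᵣ SDD G α
  bound≤SDD = ≤ᵣ-trans {bound} {cap₂} {SDD G α}
    (lowerBound≤cap α 0<α m≥1 δ (NK* G) (NK*-pos G) (δ^2m≤NK* G δ≤degree)) (cap≤SDD G α)

  equality⇒regular : SDD G α ≃ᵣ bound → Regular G
  -- The case distinction is made on naturals, where order is decidable: `δ^(2m) < NK*` would give
  -- `bound <ᵣ cap₂`, against `cap₂ ≤ᵣ SDD G α ≃ᵣ bound`.
  equality⇒regular eq = NK*≤δ^2m⇒regular G δ≤degree (ℕ.≮⇒≥ λ δ^2m<NK* → ≤ᵣ⇒≮ᵣ {cap₂} {bound}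
    (≤ᵣ-trans {cap₂} {SDD G α} {bound} (cap≤SDD G α) (≃ᵣ⇒≤ᵣ {SDD G α} {bound} eq))
    (lowerBound<cap α 0<α m≥1 δ (NK* G) (NK*-pos G) δ^2m<NK*))

  regular⇒equality : Regular G → SDD G α ≃ᵣ bound
  regular⇒equality regular = ≤ᵣ-antisym {SDD G α} {bound}
    (≤ᵣ-trans {SDD G α} {cap₂} {bound} (SDD≤cap G α regular)
      (cap≤lowerBound α 0<α m≥1 δ (NK* G) (NK*-pos G)
        (NK*≡δ^2m G (λ u → trans (regular u u₀) degree-u₀≡δ))))
    bound≤SDD
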